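{- Let $k\ge 3$. Among all relaxations of the $k$-way cut problem based on embeddings in the simplex that minimize the volume measured by some norm (without adding other constraints), the (scaled) $L_1$ norm has the smallest possible integrality gap. That is: for every norm $\|\cdot\|'$ on $\mathbb{R}^k$ for which minimizing $\mathrm{vol}_{\|\cdot\|'}$ is a relaxation of the $k$-way cut problem, the integrality gap of the relaxation given by $\|\cdot\|'$ is at least the integrality gap of the relaxation given by the norm $|\cdot| = \tfrac12\|\cdot\|_1$.
   Context: Let $\Delta=\{x\in\mathbb{R}^k : x\ge 0,\ \sum_i x_i=1\}$; its $i$-th vertex is the point with $x_i=1$. An instance is a finite undirected graph $G$ with nonnegative edge costs and $k$ distinguished nodes, terminals $1,\dots,k$. A $k$-way cut of $G$ is a set of edges whose removal disconnects each terminal from all the others; its cost is the sum of its edge costs. An embedding of $G$ is a map $\phi$ from the nodes of $G$ to $\Delta$ sending terminal $i$ to the $i$-th vertex of $\Delta$. For a norm $N$ on $\mathbb{R}^k$, the volume of the embedding is $\mathrm{vol}_N=\sum_{uv}\mathrm{cost}(uv)\,N(\phi(u)-\phi(v))$, summed over edges $uv$ of $G$. Minimizing $\mathrm{vol}_N$ over embeddings is a relaxation of $k$-way cut if for every instance the minimum volume is at most the minimum cost of a $k$-way cut (equivalently, any two vertices of $\Delta$ are at $N$-distance at most $1$). The integrality gap of the relaxation given by $N$ is the supremum, over all instances $G$ (with positive minimum volume), of the minimum cost of a $k$-way cut of $G$ divided by the minimum of $\mathrm{vol}_N$ over embeddings of $G$. -}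

module Defs where

open import Level using (0ℓ) renaming (suc to lsuc)
open import Algebra.Bundles using (CommutativeRing)
open import Data.Bool.Base using (if_then_else_)
open import Data.Fin.Base as Fin using (Fin; zero; suc)
import Data.Fin.Properties as Fin
open import Data.Fin.Subset using (Subset; _∉_)
open import Data.Nat.Base using (ℕ; zero; suc)
open import Data.Product.Base using (_×_; ∃; ∃-syntax; proj₁; proj₂)
open import Data.Sum.Base using (inj₁; inj₂)
open import Data.Vec.Base using (lookup)
open import Data.Vec.Functional using (Vector)
open import Function.Definitions using (Injective)
open import Relation.Binary.Bundles using (TotalOrder)
open import Relation.Binary.Core using (Rel)
open import Relation.Binary.Structures using (IsTotalOrder)
open import Relation.Binary.PropositionalEquality.Core using (_≡_)
open import Relation.Binary.Construct.Closure.Equivalence using (EqClosure)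
open import Relation.Nullary.Construct.Add.Supremum using (_⁺; [_])
open import Relation.Nullary.Decidable.Core using (does)
open import Relation.Nullary.Negation.Core using (¬_; contradiction)
open import Relation.Unary using (Pred)
open import Algebra.Construct.NaturalChoice.Base using (MaxOperator)
import Algebra.Construct.NaturalChoice.Max as Max
import Algebra.Construct.NaturalChoice.MaxOp as MaxOp
import Algebra.Properties.CommutativeMonoid.Sum as Sum
import Algebra.Properties.Ring as RingProperties
import Algebra.Properties.Semiring.Sum as SemiringSum
import Relation.Binary.Construct.Add.Supremum.NonStrict as AddSupremum
import Relation.Binary.Construct.NonStrictToStrict as ToStrict
import Relation.Binary.Reasoning.Setoid as SetoidReasoning

-- The real numbers, given by their categorical axiomatisation: a totally
-- ordered field in which every inhabited set that is bounded above has a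
-- least upper bound.  Such a field is unique up to isomorphism.  Equality is
-- a setoid equality, so that reals represented by Cauchy sequences qualify.
record CompleteOrderedField : Set (lsuc 0ℓ) where
  infix 4 _≤_
  field
    commutativeRing : CommutativeRing 0ℓ 0ℓ

  open CommutativeRing commutativeRing public

  field
    0≉1          : ¬ 0# ≈ 1#
    inverse      : ∀ x → ¬ x ≈ 0# → ∃[ y ] x * y ≈ 1#
    _≤_          : Rel Carrier 0ℓ
    isTotalOrder : IsTotalOrder _≈_ _≤_
    +-monoˡ-≤    : ∀ z {x y} → x ≤ y → x + z ≤ y + z
    *-nonNeg     : ∀ {x y} → 0# ≤ x → 0# ≤ y → 0# ≤ x * y
    complete     : (P : Pred Carrier 0ℓ) → ∃ P →
                   (∃[ b ] (∀ x → P x → x ≤ b)) →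
                   ∃[ s ] ((∀ x → P x → x ≤ s) ×
                           (∀ b → (∀ x → P x → x ≤ b) → s ≤ b))

module RealNumbers (ℝ : CompleteOrderedField) where

  open CompleteOrderedField ℝ public hiding (zero)
  open IsTotalOrder isTotalOrder public
    using (total; antisym; ≤-respˡ-≈; ≤-respʳ-≈)
    renaming (trans to ≤-trans; reflexive to ≤-reflexive; refl to ≤-refl)
  open ToStrict _≈_ _≤_ public using (_<_)
  open AddSupremum _≤_ public using (_≤⁺_)
  open Sum +-commutativeMonoid public using (sum; sum-cong-≋; ∑-distrib-+)
  open SemiringSum semiring public using (*-distribˡ-sum)
  open RingProperties ring public
    using (-‿distribˡ-*; -‿distribʳ-*; -0#≈0#; -‿involutive; -‿+-comm)

  totalOrder : TotalOrder 0ℓ 0ℓ 0ℓ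
  totalOrder = record { isTotalOrder = isTotalOrder }

  open Max totalOrder public using (_⊔_; maxOperator)
  open MaxOperator maxOperator public using (x≤y⇒x⊔y≈y; x≥y⇒x⊔y≈x)
  open MaxOp maxOperator public
    using (⊔-cong; ⊔-lub; x≤x⊔y; x≤y⊔x)

  ∣_∣ : Carrier → Carrier
  ∣ x ∣ = x ⊔ - x

  +-mono-≤ : ∀ {w x y z} → w ≤ x → y ≤ z → w + y ≤ x + z
  +-mono-≤ {w} {x} {y} {z} w≤x y≤z = ≤-trans (+-monoˡ-≤ y w≤x)
    (≤-respˡ-≈ (+-comm y x) (≤-respʳ-≈ (+-comm z x) (+-monoˡ-≤ x y≤z)))

  x≤0⇒0≤-x : ∀ {x} → x ≤ 0# → 0# ≤ - x
  x≤0⇒0≤-x {x} x≤0 = ≤-respˡ-≈ (-‿inverseʳ x)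
    (≤-respʳ-≈ (+-identityˡ (- x)) (+-monoˡ-≤ (- x) x≤0))

  0≤x⇒-x≤0 : ∀ {x} → 0# ≤ x → - x ≤ 0#
  0≤x⇒-x≤0 {x} 0≤x = ≤-respˡ-≈ (+-identityˡ (- x))
    (≤-respʳ-≈ (-‿inverseʳ x) (+-monoˡ-≤ (- x) 0≤x))

  0≤x⇒∣x∣≈x : ∀ {x} → 0# ≤ x → ∣ x ∣ ≈ x
  0≤x⇒∣x∣≈x 0≤x = x≥y⇒x⊔y≈x (≤-trans (0≤x⇒-x≤0 0≤x) 0≤x)

  x≤0⇒∣x∣≈-x : ∀ {x} → x ≤ 0# → ∣ x ∣ ≈ - x
  x≤0⇒∣x∣≈-x x≤0 = x≤y⇒x⊔y≈y (≤-trans x≤0 (x≤0⇒0≤-x x≤0))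

  ∣∣-cong : ∀ {x y} → x ≈ y → ∣ x ∣ ≈ ∣ y ∣
  ∣∣-cong x≈y = ⊔-cong x≈y (-‿cong x≈y)

  0≤∣x∣ : ∀ x → 0# ≤ ∣ x ∣
  0≤∣x∣ x with total 0# x
  ... | inj₁ 0≤x = ≤-trans 0≤x (x≤x⊔y x (- x))
  ... | inj₂ x≤0 = ≤-trans (x≤0⇒0≤-x x≤0) (x≤y⊔x x (- x))

  ∣x∣≈0⇒x≈0 : ∀ {x} → ∣ x ∣ ≈ 0# → x ≈ 0#
  ∣x∣≈0⇒x≈0 {x} eq with total 0# x
  ... | inj₁ 0≤x = trans (sym (0≤x⇒∣x∣≈x 0≤x)) eq
  ... | inj₂ x≤0 = trans (sym (-‿involutive x))
    (trans (-‿cong (trans (sym (x≤0⇒∣x∣≈-x x≤0)) eq)) -0#≈0#)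

  ∣x+y∣≤∣x∣+∣y∣ : ∀ x y → ∣ x + y ∣ ≤ ∣ x ∣ + ∣ y ∣
  ∣x+y∣≤∣x∣+∣y∣ x y = ⊔-lub
    (+-mono-≤ (x≤x⊔y x (- x)) (x≤x⊔y y (- y)))
    (≤-respˡ-≈ (-‿+-comm x y) (+-mono-≤ (x≤y⊔x x (- x)) (x≤y⊔x y (- y))))

  -x*-y≈x*y : ∀ x y → (- x) * (- y) ≈ x * y
  -x*-y≈x*y x y = trans (sym (-‿distribˡ-* x (- y)))
    (trans (-‿cong (sym (-‿distribʳ-* x y))) (-‿involutive (x * y)))

  ∣x*y∣≈∣x∣*∣y∣ : ∀ x y → ∣ x * y ∣ ≈ ∣ x ∣ * ∣ y ∣
  ∣x*y∣≈∣x∣*∣y∣ x y with total 0# x | total 0# y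
  ... | inj₁ 0≤x | inj₁ 0≤y = trans (0≤x⇒∣x∣≈x (*-nonNeg 0≤x 0≤y))
    (*-cong (sym (0≤x⇒∣x∣≈x 0≤x)) (sym (0≤x⇒∣x∣≈x 0≤y)))
  ... | inj₁ 0≤x | inj₂ y≤0 = trans
    (x≤0⇒∣x∣≈-x (≤-respˡ-≈ (-‿involutive (x * y)) (0≤x⇒-x≤0
      (≤-respʳ-≈ (sym (-‿distribʳ-* x y)) (*-nonNeg 0≤x (x≤0⇒0≤-x y≤0))))))
    (trans (-‿distribʳ-* x y)
      (*-cong (sym (0≤x⇒∣x∣≈x 0≤x)) (sym (x≤0⇒∣x∣≈-x y≤0))))
  ... | inj₂ x≤0 | inj₁ 0≤y = trans
    (x≤0⇒∣x∣≈-x (≤-respˡ-≈ (-‿involutive (x * y)) (0≤x⇒-x≤0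
      (≤-respʳ-≈ (sym (-‿distribˡ-* x y)) (*-nonNeg (x≤0⇒0≤-x x≤0) 0≤y)))))
    (trans (-‿distribˡ-* x y)
      (*-cong (sym (x≤0⇒∣x∣≈-x x≤0)) (sym (0≤x⇒∣x∣≈x 0≤y))))
  ... | inj₂ x≤0 | inj₂ y≤0 = trans
    (0≤x⇒∣x∣≈x (≤-respʳ-≈ (-x*-y≈x*y x y)
      (*-nonNeg (x≤0⇒0≤-x x≤0) (x≤0⇒0≤-x y≤0))))
    (trans (sym (-x*-y≈x*y x y))
      (*-cong (sym (x≤0⇒∣x∣≈-x x≤0)) (sym (x≤0⇒∣x∣≈-x y≤0))))

  0≤1 : 0# ≤ 1#
  0≤1 with total 0# 1#
  ... | inj₁ 0≤1 = 0≤1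
  ... | inj₂ 1≤0 = ≤-respʳ-≈ (trans (-x*-y≈x*y 1# 1#) (*-identityˡ 1#))
    (*-nonNeg (x≤0⇒0≤-x 1≤0) (x≤0⇒0≤-x 1≤0))

  2≉0 : ¬ 1# + 1# ≈ 0#
  2≉0 2≈0 = contradiction (antisym 0≤1 1≤0) 0≉1
    where
    1≤0 : 1# ≤ 0#
    1≤0 = ≤-respʳ-≈ 2≈0 (≤-respˡ-≈ (+-identityˡ 1#) (+-monoˡ-≤ 1# 0≤1))

  ½ : Carrier
  ½ = proj₁ (inverse (1# + 1#) 2≉0)

  2*½≈1 : (1# + 1#) * ½ ≈ 1#
  2*½≈1 = proj₂ (inverse (1# + 1#) 2≉0)

  0≤½ : 0# ≤ ½
  0≤½ with total 0# ½
  ... | inj₁ 0≤½ = 0≤½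
  ... | inj₂ ½≤0 = contradiction (antisym 0≤1 1≤0) 0≉1
    where
    ½+½≈1 : ½ + ½ ≈ 1#
    ½+½≈1 = trans (+-cong (sym (*-identityˡ ½)) (sym (*-identityˡ ½)))
      (trans (sym (distribʳ ½ 1# 1#)) 2*½≈1)
    1≤0 : 1# ≤ 0#
    1≤0 = ≤-respˡ-≈ ½+½≈1 (≤-respʳ-≈ (+-identityˡ 0#) (+-mono-≤ ½≤0 ½≤0))

  *-monoˡ-≤ : ∀ {a x y} → 0# ≤ a → x ≤ y → a * x ≤ a * y
  *-monoˡ-≤ {a} {x} {y} 0≤a x≤y =
    ≤-respˡ-≈ (+-identityˡ (a * x)) (≤-respʳ-≈ eq
      (+-monoˡ-≤ (a * x) (*-nonNeg 0≤a 0≤y-x)))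
    where
    0≤y-x : 0# ≤ y - x
    0≤y-x = ≤-respˡ-≈ (-‿inverseʳ x) (+-monoˡ-≤ (- x) x≤y)
    eq : a * (y - x) + a * x ≈ a * y
    eq = trans (sym (distribˡ a (y - x) x)) (*-congˡ
      (trans (+-assoc y (- x) x)
        (trans (+-congˡ (-‿inverseˡ x)) (+-identityʳ y))))

  sum-mono-≤ : ∀ {n} {f g : Vector Carrier n} →
               (∀ i → f i ≤ g i) → sum f ≤ sum g
  sum-mono-≤ {zero}  f≤g = ≤-refl
  sum-mono-≤ {suc n} f≤g =
    +-mono-≤ (f≤g zero) (sum-mono-≤ (λ i → f≤g (suc i)))

  sum-nonNeg : ∀ {n} {f : Vector Carrier n} →
               (∀ i → 0# ≤ f i) → 0# ≤ sum f
  sum-nonNeg {zero}  0≤f = ≤-refl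
  sum-nonNeg {suc n} 0≤f = ≤-respˡ-≈ (+-identityˡ 0#)
    (+-mono-≤ (0≤f zero) (sum-nonNeg (λ i → 0≤f (suc i))))

  x≤sum : ∀ {n} {f : Vector Carrier n} →
          (∀ i → 0# ≤ f i) → ∀ i → f i ≤ sum f
  x≤sum {suc n} {f} 0≤f zero = ≤-respˡ-≈ (+-identityʳ (f zero))
    (+-mono-≤ ≤-refl (sum-nonNeg (λ i → 0≤f (suc i))))
  x≤sum {suc n} {f} 0≤f (suc i) = ≤-respˡ-≈ (+-identityˡ (f (suc i)))
    (+-mono-≤ (0≤f zero) (x≤sum (λ j → 0≤f (suc j)) i))

  IsMinimum : Pred Carrier 0ℓ → Carrier → Set
  IsMinimum P m = P m × (∀ x → P x → m ≤ x)

  -- Suprema are taken in the reals extended by a point ⊤⁺ at infinity.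
  IsUpperBound : Pred Carrier 0ℓ → Carrier ⁺ → Set
  IsUpperBound P b = ∀ x → P x → [ x ] ≤⁺ b

  IsSupremum : Pred Carrier 0ℓ → Carrier ⁺ → Set
  IsSupremum P s = IsUpperBound P s × (∀ b → IsUpperBound P b → s ≤⁺ b)

  -- Nonnegativity of ∥_∥ follows from the other axioms.
  record Norm (k : ℕ) : Set where
    field
      ∥_∥         : Vector Carrier k → Carrier
      cong        : ∀ {x y} → (∀ i → x i ≈ y i) → ∥ x ∥ ≈ ∥ y ∥
      definite    : ∀ {x} → ∥ x ∥ ≈ 0# → ∀ i → x i ≈ 0#
      homogeneous : ∀ a x → ∥ (λ i → a * x i) ∥ ≈ ∣ a ∣ * ∥ x ∥
      triangle    : ∀ x y → ∥ (λ i → x i + y i) ∥ ≤ ∥ x ∥ + ∥ y ∥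

  ∥_∥₁ : ∀ {k} → Vector Carrier k → Carrier
  ∥ x ∥₁ = sum (λ i → ∣ x i ∣)

  ½ℓ₁ : ∀ k → Norm k
  ½ℓ₁ k = record
    { ∥_∥         = λ x → ½ * ∥ x ∥₁
    ; cong        = λ x≈y → *-congˡ (sum-cong-≋ (λ i → ∣∣-cong (x≈y i)))
    ; definite    = definite
    ; homogeneous = homogeneous
    ; triangle    = λ x y → ≤-respʳ-≈ (distribˡ ½ ∥ x ∥₁ ∥ y ∥₁)
        (*-monoˡ-≤ 0≤½ (≤-respʳ-≈ (∑-distrib-+ (λ i → ∣ x i ∣) (λ i → ∣ y i ∣))
          (sum-mono-≤ (λ i → ∣x+y∣≤∣x∣+∣y∣ (x i) (y i)))))
    }
    where
    open SetoidReasoning setoid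

    definite : {x : Vector Carrier k} → ½ * ∥ x ∥₁ ≈ 0# → ∀ i → x i ≈ 0#
    definite {x} eq i = ∣x∣≈0⇒x≈0 (antisym
      (≤-respʳ-≈ ∥x∥₁≈0 (x≤sum (λ j → 0≤∣x∣ (x j)) i)) (0≤∣x∣ (x i)))
      where
      ∥x∥₁≈0 : ∥ x ∥₁ ≈ 0#
      ∥x∥₁≈0 = begin
        ∥ x ∥₁                      ≈⟨ *-identityˡ _ ⟨
        1# * ∥ x ∥₁                 ≈⟨ *-congʳ 2*½≈1 ⟨
        ((1# + 1#) * ½) * ∥ x ∥₁    ≈⟨ *-assoc _ _ _ ⟩
        (1# + 1#) * (½ * ∥ x ∥₁)    ≈⟨ *-congˡ eq ⟩
        (1# + 1#) * 0#              ≈⟨ zeroʳ _ ⟩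
        0#                          ∎

    homogeneous : ∀ a (x : Vector Carrier k) →
                  ½ * ∥ (λ i → a * x i) ∥₁ ≈ ∣ a ∣ * (½ * ∥ x ∥₁)
    homogeneous a x = begin
      ½ * ∥ (λ i → a * x i) ∥₁
        ≈⟨ *-congˡ (sum-cong-≋ (λ i → ∣x*y∣≈∣x∣*∣y∣ a (x i))) ⟩
      ½ * sum (λ i → ∣ a ∣ * ∣ x i ∣)
        ≈⟨ *-congˡ (*-distribˡ-sum ∣ a ∣ (λ i → ∣ x i ∣)) ⟨
      ½ * (∣ a ∣ * ∥ x ∥₁)   ≈⟨ *-assoc _ _ _ ⟨
      (½ * ∣ a ∣) * ∥ x ∥₁   ≈⟨ *-congʳ (*-comm _ _) ⟩
      (∣ a ∣ * ½) * ∥ x ∥₁   ≈⟨ *-assoc _ _ _ ⟩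
      ∣ a ∣ * (½ * ∥ x ∥₁)   ∎

  -- A simple graph: the edges are numbered, and edge e is the unordered pair
  -- of distinct nodes {src e , tgt e}, stored with its smaller node first.
  record Instance (k : ℕ) : Set where
    field
      #nodes #edges : ℕ
      src tgt       : Fin #edges → Fin #nodes
      src<tgt       : ∀ e → src e Fin.< tgt e
      distinct      : ∀ {d e} → src d ≡ src e → tgt d ≡ tgt e → d ≡ e
      cost          : Vector Carrier #edges
      cost-nonNeg   : ∀ e → 0# ≤ cost e
      terminal      : Fin k → Fin #nodes
      terminal-inj  : Injective _≡_ _≡_ terminal

  module _ {k : ℕ} (G : Instance k) where
    open Instance G

    EdgeOutside : Subset #edges → Rel (Fin #nodes) 0ℓ
    EdgeOutside C u v = ∃[ e ] (e ∉ C × src e ≡ u × tgt e ≡ v)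

    ConnectedOutside : Subset #edges → Rel (Fin #nodes) 0ℓ
    ConnectedOutside C = EqClosure (EdgeOutside C)

    IsCut : Subset #edges → Set
    IsCut C = ∀ i j → ¬ i ≡ j → ¬ ConnectedOutside C (terminal i) (terminal j)

    cutCost : Subset #edges → Carrier
    cutCost C = sum (λ e → if lookup C e then cost e else 0#)

    IsMinCutCost : Carrier → Set
    IsMinCutCost = IsMinimum (λ c → ∃[ C ] (IsCut C × c ≈ cutCost C))

  Δ : ∀ {k} → Pred (Vector Carrier k) 0ℓ
  Δ x = (∀ i → 0# ≤ x i) × sum x ≈ 1#

  vertex : ∀ {k} → Fin k → Vector Carrier k
  vertex i j = if does (i Fin.≟ j) then 1# else 0#

  module _ {k : ℕ} (G : Instance k) where
    open Instance G

    record Embedding : Set where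
      field
        φ          : Fin #nodes → Vector Carrier k
        φ∈Δ        : ∀ u → Δ (φ u)
        φ-terminal : ∀ i j → φ (terminal i) j ≈ vertex i j

    module _ (N : Norm k) where
      open Norm N

      vol : Embedding → Carrier
      vol E = sum (λ e → cost e * ∥ (λ i → φ (src e) i - φ (tgt e) i) ∥)
        where open Embedding E

      IsMinVolume : Carrier → Set
      IsMinVolume = IsMinimum (λ v → ∃[ E ] v ≈ vol E)

  module _ {k : ℕ} (N : Norm k) where

    IsRelaxation : Set
    IsRelaxation = ∀ (G : Instance k) v c →
      IsMinVolume G N v → IsMinCutCost G c → v ≤ c

    -- r is the quotient c / v, with v positive.
    IsRatio : Carrier → Set
    IsRatio r = ∃[ G ] ∃[ v ] ∃[ c ]
      (IsMinVolume G N v × IsMinCutCost G c × 0# < v × r * v ≈ c)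

    IsIntegralityGap : Carrier ⁺ → Set
    IsIntegralityGap = IsSupremum IsRatio

{-# OPTIONS --safe #-}
-- A difference x − y of two points of Δ is a nonnegative combination of
-- differences of vertices with total weight ½‖x − y‖₁.  So if the vertices are
-- at N-distance at most 1, then N(x − y) ≤ ½‖x − y‖₁, the N-volume of an
-- embedding is at most its ½ℓ₁-volume, and for each instance the ratio for N is
-- at least the one for ½ℓ₁.  That N gives a relaxation does bound these
-- distances: apply it to the graph with a single edge between two terminals.
--
-- The ratio for N exists only if the minimum volume is attained.  The volume
-- is a Lipschitz function of the embedding.  Lipschitz functions attain their
-- minimum on [0,1], hence on cubes (one coordinate at a time), hence on
-- Lipschitz images of cubes, and Δ is a Lipschitz retract of the cube.
module Submission where

open import Defs
open import Level using (0ℓ)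
open import Axiom.ExcludedMiddle using (ExcludedMiddle)
open import Data.Nat.Base using (ℕ) renaming (_≤_ to _≤ᴺ_)
open import Data.Product.Base using (_×_; ∃-syntax)

open import Algebra.Bundles using (CommutativeRing)
import Algebra.Properties.Ring as RingProperties
import Algebra.Properties.Semiring.Mult.TCOptimised as Mult
import Algebra.Solver.Ring as RingSolver
open import Algebra.Solver.Ring.AlmostCommutativeRing using (fromCommutativeRing; _-Raw-AlmostCommutative⟶_)
open import Data.Bool.Base using (true; false; if_then_else_)
open import Data.Fin.Base as Fin using (Fin; zero; suc)
import Data.Fin.Properties as Fin
open import Data.Fin.Subset using (Subset; _∉_; ⊤)
open import Data.Integer.Base as ℤ using (ℤ; -[1+_]; _⊖_; _◃_; 0ℤ; 1ℤ)
import Data.Integer.Properties as ℤ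
open import Data.Maybe.Base as Maybe using (Maybe)
open import Data.Nat.Base as ℕ using (zero; suc; s≤s; z≤n)
import Data.Nat.Properties as ℕ
open import Data.Product.Base using (_,_; ∃; proj₁; proj₂)
import Data.Sign.Base as Sign
open import Data.Sum.Base using (inj₁; inj₂; [_,_]′)
open import Data.Vec.Base using (lookup; here)
open import Data.Vec.Functional using (Vector; _∷_; head; tail)
open import Data.Vec.Properties using ([]=⇒lookup)
open import Function.Base using (id)
open import Relation.Binary.Bundles using (TotalOrder)
import Relation.Binary.Construct.Add.Supremum.NonStrict as AddSupremum
import Relation.Binary.Construct.Closure.Equivalence as EqClosure
open import Relation.Binary.Construct.Closure.ReflexiveTransitive using (ε; _◅_; _◅◅_)
open import Relation.Binary.Construct.Closure.Symmetric using (fwd; bwd)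
open import Relation.Binary.Definitions using (tri<; tri≈; tri>)
open import Relation.Binary.PropositionalEquality.Core as ≡ using (_≡_)
import Relation.Binary.Reasoning.PartialOrder as PartialOrderReasoning
import Relation.Binary.Reasoning.Setoid as SetoidReasoning
open import Relation.Nullary.Construct.Add.Supremum using (_⁺; [_]; ⊤⁺)
open import Relation.Nullary.Decidable.Core using (Dec; yes; no; does; dec⇒maybe)
open import Relation.Nullary.Negation.Core using (¬_; contradiction)
open import Relation.Unary using (Pred)

module IntegerCoefficients {c ℓ} (R : CommutativeRing c ℓ) where
  open CommutativeRing R hiding (zero)
  open RingProperties ring
  open Mult semiring renaming (_×_ to infixl 8 _·_)
  open SetoidReasoning setoid

  fromℤ : ℤ → Carrier
  fromℤ (ℤ.+ n)  = n · 1#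
  fromℤ -[1+ n ] = - (suc n · 1#)

  -‿homo : ∀ i → fromℤ (ℤ.- i) ≈ - fromℤ i
  -‿homo (ℤ.+ zero)  = sym -0#≈0#
  -‿homo (ℤ.+ suc n) = refl
  -‿homo -[1+ n ]    = sym (-‿involutive _)

  ◃-homo⁻ : ∀ n → fromℤ (Sign.- ◃ n) ≈ - (n · 1#)
  ◃-homo⁻ zero    = sym -0#≈0#
  ◃-homo⁻ (suc n) = refl

  ◃-homo⁺ : ∀ n → fromℤ (Sign.+ ◃ n) ≈ n · 1#
  ◃-homo⁺ zero    = refl
  ◃-homo⁺ (suc n) = refl

  ⊖-homo : ∀ m n → fromℤ (m ⊖ n) ≈ m · 1# - n · 1#
  ⊖-homo zero    zero    = sym (-‿inverseʳ 0#)
  ⊖-homo zero    (suc n) = sym (+-identityˡ _)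
  ⊖-homo (suc m) zero    = sym (trans (+-congˡ -0#≈0#) (+-identityʳ _))
  ⊖-homo (suc m) (suc n) = begin
    fromℤ (suc m ⊖ suc n)                  ≡⟨ ≡.cong fromℤ (ℤ.[1+m]⊖[1+n]≡m⊖n m n) ⟩
    fromℤ (m ⊖ n)                          ≈⟨ ⊖-homo m n ⟩
    m · 1# - n · 1#                        ≈⟨ +-congʳ (xyx⁻¹≈y 1# (m · 1#)) ⟨
    ((1# + m · 1#) - 1#) - n · 1#          ≈⟨ +-assoc _ _ _ ⟩
    (1# + m · 1#) + (- 1# - n · 1#)        ≈⟨ +-congˡ (-‿+-comm 1# (n · 1#)) ⟩
    (1# + m · 1#) - (1# + n · 1#)          ≈⟨ +-cong (1+× m 1#) (-‿cong (1+× n 1#)) ⟨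
    suc m · 1# - suc n · 1#                ∎

  +-homo : ∀ i j → fromℤ (i ℤ.+ j) ≈ fromℤ i + fromℤ j
  +-homo (ℤ.+ m)  (ℤ.+ n)  = ×-homo-+ 1# m n
  +-homo (ℤ.+ m)  -[1+ n ] = ⊖-homo m (suc n)
  +-homo -[1+ m ] (ℤ.+ n)  = trans (⊖-homo n (suc m)) (+-comm _ _)
  +-homo -[1+ m ] -[1+ n ] = begin
    - (suc (suc (m ℕ.+ n)) · 1#)           ≡⟨ ≡.cong (λ l → - (suc l · 1#)) (ℕ.+-suc m n) ⟨
    - ((suc m ℕ.+ suc n) · 1#)             ≈⟨ -‿cong (×-homo-+ 1# (suc m) (suc n)) ⟩
    - (suc m · 1# + suc n · 1#)            ≈⟨ -‿+-comm _ _ ⟨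
    - (suc m · 1#) - suc n · 1#            ∎

  *-homo : ∀ i j → fromℤ (i ℤ.* j) ≈ fromℤ i * fromℤ j
  *-homo (ℤ.+ m)  (ℤ.+ n)  = trans (◃-homo⁺ (m ℕ.* n)) (×1-homo-* m n)
  *-homo (ℤ.+ m)  -[1+ n ] = begin
    fromℤ (Sign.- ◃ m ℕ.* suc n)           ≈⟨ ◃-homo⁻ (m ℕ.* suc n) ⟩
    - ((m ℕ.* suc n) · 1#)                 ≈⟨ -‿cong (×1-homo-* m (suc n)) ⟩
    - (m · 1# * (suc n · 1#))              ≈⟨ -‿distribʳ-* _ _ ⟩
    m · 1# * - (suc n · 1#)                ∎
  *-homo -[1+ m ] (ℤ.+ n)  = begin
    fromℤ (Sign.- ◃ suc m ℕ.* n)           ≈⟨ ◃-homo⁻ (suc m ℕ.* n) ⟩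
    - ((suc m ℕ.* n) · 1#)                 ≈⟨ -‿cong (×1-homo-* (suc m) n) ⟩
    - (suc m · 1# * (n · 1#))              ≈⟨ -‿distribˡ-* _ _ ⟩
    - (suc m · 1#) * (n · 1#)              ∎
  *-homo -[1+ m ] -[1+ n ] = begin
    (suc m ℕ.* suc n) · 1#                 ≈⟨ ×1-homo-* (suc m) (suc n) ⟩
    suc m · 1# * (suc n · 1#)              ≈⟨ -‿involutive _ ⟨
    - - (suc m · 1# * (suc n · 1#))        ≈⟨ -‿cong (-‿distribʳ-* _ _) ⟩
    - (suc m · 1# * - (suc n · 1#))        ≈⟨ -‿distribˡ-* _ _ ⟩
    - (suc m · 1#) * - (suc n · 1#)        ∎

  fromℤ-homomorphism : ℤ.+-*-rawRing -Raw-AlmostCommutative⟶ fromCommutativeRing R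
  fromℤ-homomorphism = record
    { ⟦_⟧    = fromℤ
    ; +-homo = +-homo
    ; *-homo = *-homo
    ; -‿homo = -‿homo
    ; 0-homo = refl
    ; 1-homo = refl
    }

  fromℤ≈? : ∀ i j → Maybe (fromℤ i ≈ fromℤ j)
  fromℤ≈? i j = Maybe.map (λ i≡j → reflexive (≡.cong fromℤ i≡j)) (dec⇒maybe (i ℤ.≟ j))

  open RingSolver ℤ.+-*-rawRing (fromCommutativeRing R) fromℤ-homomorphism fromℤ≈? public

module OrderedField (ℝ : CompleteOrderedField) where
  open RealNumbers ℝ public
  open IntegerCoefficients commutativeRing public
    using (solve; _:=_; _:+_; _:*_; _:-_; :-_; con)
  module ≤-Reasoning = PartialOrderReasoning (TotalOrder.poset totalOrder)

  x≤y⇒0≤y-x : ∀ {x y} → x ≤ y → 0# ≤ y - x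
  x≤y⇒0≤y-x {x} x≤y = ≤-respˡ-≈ (-‿inverseʳ x) (+-monoˡ-≤ (- x) x≤y)

  0≤d∧y≈x+d⇒x≤y : ∀ {x y d} → 0# ≤ d → y ≈ x + d → x ≤ y
  0≤d∧y≈x+d⇒x≤y {x} 0≤d y≈x+d =
    ≤-respˡ-≈ (+-identityʳ x) (≤-respʳ-≈ (sym y≈x+d) (+-mono-≤ ≤-refl 0≤d))

  +-nonNeg : ∀ {x y} → 0# ≤ x → 0# ≤ y → 0# ≤ x + y
  +-nonNeg 0≤x 0≤y = ≤-respˡ-≈ (+-identityˡ 0#) (+-mono-≤ 0≤x 0≤y)

  x≤x+y : ∀ {x y} → 0# ≤ y → x ≤ x + y
  x≤x+y 0≤y = 0≤d∧y≈x+d⇒x≤y 0≤y refl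

  1≰0 : ¬ 1# ≤ 0#
  1≰0 1≤0 = 0≉1 (antisym 0≤1 1≤0)

  inverse-nonNeg : ∀ {x} → 0# ≤ x → ¬ x ≈ 0# → ∃[ y ] (x * y ≈ 1# × 0# ≤ y)
  inverse-nonNeg {x} 0≤x x≉0 with inverse x x≉0
  ... | y , xy≈1 with total 0# y
  ...   | inj₁ 0≤y = y , xy≈1 , 0≤y
  ...   | inj₂ y≤0 = contradiction
    (≤-respˡ-≈ xy≈1 (≤-respʳ-≈ (zeroʳ x) (*-monoˡ-≤ 0≤x y≤0))) 1≰0

  *-cancelˡ-≤ : ∀ {a x y} → 0# ≤ a → ¬ a ≈ 0# → a * x ≤ a * y → x ≤ y
  *-cancelˡ-≤ {a} {x} {y} 0≤a a≉0 ax≤ay with inverse-nonNeg 0≤a a≉0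
  ... | b , ab≈1 , 0≤b = ≤-respˡ-≈ (cancel x) (≤-respʳ-≈ (cancel y) (*-monoˡ-≤ 0≤b ax≤ay))
    where
    cancel : ∀ z → b * (a * z) ≈ z
    cancel z = trans (sym (*-assoc b a z))
      (trans (*-congʳ (trans (*-comm b a) ab≈1)) (*-identityˡ z))

  x-y≤z⇒x≤y+z : ∀ {x y z} → x - y ≤ z → x ≤ y + z
  x-y≤z⇒x≤y+z {x} {y} {z} x-y≤z = 0≤d∧y≈x+d⇒x≤y (x≤y⇒0≤y-x x-y≤z)
    (solve 3 (λ x y z → y :+ z := x :+ (z :- (x :- y))) refl x y z)

  x≤y+z⇒x-y≤z : ∀ {x y z} → x ≤ y + z → x - y ≤ z
  x≤y+z⇒x-y≤z {x} {y} {z} x≤y+z = 0≤d∧y≈x+d⇒x≤y (x≤y⇒0≤y-x x≤y+z)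
    (solve 3 (λ x y z → z := (x :- y) :+ ((y :+ z) :- x)) refl x y z)

  x≤∣x∣ : ∀ x → x ≤ ∣ x ∣
  x≤∣x∣ x = x≤x⊔y x (- x)

  ∣x-y∣≤z : ∀ {x y z} → x ≤ y + z → y ≤ x + z → ∣ x - y ∣ ≤ z
  ∣x-y∣≤z {x} {y} {z} x≤y+z y≤x+z = ⊔-lub (x≤y+z⇒x-y≤z x≤y+z)
    (≤-respˡ-≈ (solve 2 (λ x y → y :- x := :- (x :- y)) refl x y) (x≤y+z⇒x-y≤z y≤x+z))

  x≤y+∣x-y∣ : ∀ x y → x ≤ y + ∣ x - y ∣
  x≤y+∣x-y∣ x y = x-y≤z⇒x≤y+z (x≤∣x∣ (x - y))

  ∣x-y∣≈∣y-x∣ : ∀ x y → ∣ x - y ∣ ≈ ∣ y - x ∣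
  ∣x-y∣≈∣y-x∣ x y = antisym (le x y) (le y x)
    where
    le : ∀ x y → ∣ x - y ∣ ≤ ∣ y - x ∣
    le x y = ∣x-y∣≤z
      (x-y≤z⇒x≤y+z (≤-respˡ-≈ (solve 2 (λ x y → :- (y :- x) := x :- y) refl x y)
        (x≤y⊔x (y - x) (- (y - x)))))
      (x≤y+∣x-y∣ y x)

  x≈0⇒∣x∣≈0 : ∀ {x} → x ≈ 0# → ∣ x ∣ ≈ 0#
  x≈0⇒∣x∣≈0 x≈0 = trans (0≤x⇒∣x∣≈x (≤-reflexive (sym x≈0))) x≈0

  sum-zero : ∀ {n} {f : Vector Carrier n} → (∀ i → f i ≈ 0#) → sum f ≈ 0#
  sum-zero {zero}  f≈0 = refl
  sum-zero {suc n} f≈0 = trans (+-cong (f≈0 zero) (sum-zero (λ i → f≈0 (suc i)))) (+-identityˡ 0#)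

module Minimisation (em : ExcludedMiddle 0ℓ) (ℝ : CompleteOrderedField) where
  open OrderedField ℝ
  open ≤-Reasoning

  AttainsMinima : (X : Set) → (X → X → Carrier) → Set
  AttainsMinima X d = (F : X → Carrier) (L : Carrier) → 0# ≤ L →
    (∀ x y → F x ≤ F y + L * d x y) → ∃[ x ] (∀ y → F x ≤ F y)

  Interval : Set
  Interval = ∃[ x ] (0# ≤ x × x ≤ 1#)

  -- The minimiser is the supremum s of those t for which the values of F on
  -- [t , 1] come below every value of F: if F x < F s, then the points with
  -- values at most F x keep a distance η from s, so s + η has this property too.
  interval-attains : AttainsMinima Interval (λ x y → ∣ proj₁ x - proj₁ y ∣)
  interval-attains F L 0≤L lipschitz = s , minimal
    where
    0ᴵ : Interval
    0ᴵ = 0# , ≤-refl , 0≤1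

    Low : Carrier → Set
    Low t = ∀ x → ∃[ y ] (t ≤ proj₁ y × F y ≤ F x)

    low-0 : Low 0#
    low-0 x = x , proj₁ (proj₂ x) , ≤-refl

    low≤1 : ∀ t → Low t → t ≤ 1#
    low≤1 t low with low 0ᴵ
    ... | (y , 0≤y , y≤1) , t≤y , _ = ≤-trans t≤y y≤1

    supremum = complete Low (0# , low-0) (1# , low≤1)

    ŝ : Carrier
    ŝ = proj₁ supremum

    low≤ŝ : ∀ t → Low t → t ≤ ŝ
    low≤ŝ = proj₁ (proj₂ supremum)

    s : Interval
    s = ŝ , low≤ŝ 0# low-0 , proj₂ (proj₂ supremum) 1# low≤1

    minimal : ∀ x → F s ≤ F x
    minimal x with em {P = F s ≤ F x}
    ... | yes Fs≤Fx = Fs≤Fx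
    ... | no  Fs≰Fx = contradiction Fs≤Fx Fs≰Fx
      where
      0≤L+1 : 0# ≤ L + 1#
      0≤L+1 = +-nonNeg 0≤L 0≤1

      L+1≉0 : ¬ L + 1# ≈ 0#
      L+1≉0 L+1≈0 = 1≰0 (≤-respʳ-≈ L+1≈0 (≤-respʳ-≈ (+-comm 1# L) (x≤x+y 0≤L)))

      b : Carrier
      b = proj₁ (inverse (L + 1#) L+1≉0)

      η : Carrier
      η = (F s - F x) * b

      Fs≈Fx+[L+1]η : F s ≈ F x + (L + 1#) * η
      Fs≈Fx+[L+1]η = begin-equality
        F s                              ≈⟨ solve 2 (λ u v → u := v :+ (u :- v) :* con 1ℤ) refl (F s) (F x) ⟩
        F x + (F s - F x) * 1#           ≈⟨ +-congˡ (*-congˡ (proj₂ (inverse (L + 1#) L+1≉0))) ⟨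
        F x + (F s - F x) * ((L + 1#) * b)
          ≈⟨ +-congˡ (solve 3 (λ d l b → d :* (l :* b) := l :* (d :* b)) refl (F s - F x) (L + 1#) b) ⟩
        F x + (L + 1#) * η               ∎

      η≤0⇒Fs≤Fx : η ≤ 0# → F s ≤ F x
      η≤0⇒Fs≤Fx η≤0 = begin
        F s                    ≈⟨ Fs≈Fx+[L+1]η ⟩
        F x + (L + 1#) * η     ≤⟨ +-mono-≤ ≤-refl (*-monoˡ-≤ 0≤L+1 η≤0) ⟩
        F x + (L + 1#) * 0#    ≈⟨ solve 2 (λ u l → u :+ l :* con 0ℤ := u) refl (F x) (L + 1#) ⟩
        F x                    ∎

      near⇒η≤0 : ∀ y → F y ≤ F x → ∣ ŝ - proj₁ y ∣ ≤ η → η ≤ 0#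
      near⇒η≤0 y Fy≤Fx near = 0≤d∧y≈x+d⇒x≤y (x≤y⇒0≤y-x bound)
        (solve 3 (λ u l e → con 0ℤ := e :+ ((u :+ l :* e) :- (u :+ (l :+ con 1ℤ) :* e))) refl (F x) L η)
        where
        bound : F x + (L + 1#) * η ≤ F x + L * η
        bound = begin
          F x + (L + 1#) * η           ≈⟨ Fs≈Fx+[L+1]η ⟨
          F s                          ≤⟨ lipschitz s y ⟩
          F y + L * ∣ ŝ - proj₁ y ∣    ≤⟨ +-mono-≤ Fy≤Fx (*-monoˡ-≤ 0≤L near) ⟩
          F x + L * η                  ∎

      low-near-s : ¬ η ≤ 0# → ∃[ t ] (Low t × ŝ ≤ t + η)
      low-near-s η≰0 with em {P = ∃[ t ] (Low t × ŝ ≤ t + η)}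
      ... | yes found = found
      ... | no  none  = contradiction η≤0 η≰0
        where
        bound : ∀ t → Low t → t ≤ ŝ - η
        bound t low with total ŝ (t + η)
        ... | inj₁ ŝ≤t+η = contradiction (t , low , ŝ≤t+η) none
        ... | inj₂ t+η≤ŝ = 0≤d∧y≈x+d⇒x≤y (x≤y⇒0≤y-x t+η≤ŝ)
          (solve 3 (λ s t e → s :- e := t :+ (s :- (t :+ e))) refl ŝ t η)
        η≤0 : η ≤ 0#
        η≤0 = 0≤d∧y≈x+d⇒x≤y (x≤y⇒0≤y-x (proj₂ (proj₂ supremum) (ŝ - η) bound))
          (solve 2 (λ s e → con 0ℤ := e :+ ((s :- e) :- s)) refl ŝ η)

      η≤0 : η ≤ 0#
      η≤0 with em {P = η ≤ 0#}
      ... | yes η≤0 = η≤0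
      ... | no  η≰0 with low-near-s η≰0
      ...   | t , low , ŝ≤t+η = 0≤d∧y≈x+d⇒x≤y (x≤y⇒0≤y-x (low≤ŝ (ŝ + η) low-ŝ+η))
        (solve 2 (λ s e → con 0ℤ := e :+ (s :- (s :+ e))) refl ŝ η)
        where
        below-both : ∀ x′ → ∃[ w ] (F w ≤ F x × F w ≤ F x′)
        below-both x′ with total (F x) (F x′)
        ... | inj₁ Fx≤Fx′ = x  , ≤-refl , Fx≤Fx′
        ... | inj₂ Fx′≤Fx = x′ , Fx′≤Fx , ≤-refl

        low-ŝ+η : Low (ŝ + η)
        low-ŝ+η x′ with below-both x′
        ... | w , Fw≤Fx , Fw≤Fx′ with low w
        ...   | y , t≤y , Fy≤Fw with total (ŝ + η) (proj₁ y)
        ...     | inj₁ ŝ+η≤y = y , ŝ+η≤y , ≤-trans Fy≤Fw Fw≤Fx′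
        ...     | inj₂ y≤ŝ+η = contradiction
          (near⇒η≤0 y (≤-trans Fy≤Fw Fw≤Fx)
            (∣x-y∣≤z (≤-trans ŝ≤t+η (+-mono-≤ t≤y ≤-refl)) y≤ŝ+η))
          η≰0

      Fs≤Fx : F s ≤ F x
      Fs≤Fx = η≤0⇒Fs≤Fx η≤0

  vector-attains : ∀ {X d} → AttainsMinima X d → (∀ x → d x x ≈ 0#) → ∀ n →
                   AttainsMinima (Vector X n) (λ f g → sum (λ i → d (f i) (g i)))
  vector-attains {X} {d} attains d-refl zero F L 0≤L lipschitz =
    (λ ()) , λ g → ≤-respʳ-≈ (trans (+-congˡ (zeroʳ L)) (+-identityʳ (F g))) (lipschitz _ g)
  vector-attains {X} {d} attains d-refl (suc n) F L 0≤L lipschitz =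
    x₀ ∷ rest x₀ , minimal
    where
    D : ∀ {m} → Vector X m → Vector X m → Carrier
    D f g = sum (λ i → d (f i) (g i))

    D-refl : ∀ {m} (f : Vector X m) → D f f ≈ 0#
    D-refl f = sum-zero (λ i → d-refl (f i))

    inner : ∀ x → ∃[ f ] (∀ g → F (x ∷ f) ≤ F (x ∷ g))
    inner x = vector-attains attains d-refl n (λ f → F (x ∷ f)) L 0≤L (λ f g →
      ≤-respʳ-≈ (+-congˡ (*-congˡ (trans (+-congʳ (d-refl x)) (+-identityˡ (D f g)))))
        (lipschitz (x ∷ f) (x ∷ g)))

    rest : X → Vector X n
    rest x = proj₁ (inner x)

    outer : ∃[ x ] (∀ y → F (x ∷ rest x) ≤ F (y ∷ rest y))
    outer = attains (λ x → F (x ∷ rest x)) L 0≤L (λ x y → begin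
      F (x ∷ rest x)                                 ≤⟨ proj₂ (inner x) (rest y) ⟩
      F (x ∷ rest y)                                 ≤⟨ lipschitz (x ∷ rest y) (y ∷ rest y) ⟩
      F (y ∷ rest y) + L * (d x y + D (rest y) (rest y))
        ≈⟨ +-congˡ (*-congˡ (trans (+-congˡ (D-refl (rest y))) (+-identityʳ (d x y)))) ⟩
      F (y ∷ rest y) + L * d x y                     ∎)

    x₀ : X
    x₀ = proj₁ outer

    minimal : ∀ g → F (x₀ ∷ rest x₀) ≤ F g
    minimal g = begin
      F (x₀ ∷ rest x₀)                ≤⟨ proj₂ outer (head g) ⟩
      F (head g ∷ rest (head g))      ≤⟨ proj₂ (inner (head g)) (tail g) ⟩
      F (head g ∷ tail g)             ≤⟨ lipschitz (head g ∷ tail g) g ⟩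
      F g + L * D g g                 ≈⟨ +-congˡ (trans (*-congˡ (D-refl g)) (zeroʳ L)) ⟩
      F g + 0#                        ≈⟨ +-identityʳ (F g) ⟩
      F g                             ∎

  image-attains : ∀ {X Y d d′} → AttainsMinima X d → (r : X → Y) (K : Carrier) → 0# ≤ K →
                  (∀ x x′ → d′ (r x) (r x′) ≤ K * d x x′) →
                  (∀ y → ∃[ x ] d′ (r x) y ≤ 0#) → AttainsMinima Y d′
  image-attains {X} {Y} {d} {d′} attains r K 0≤K r-lipschitz r-onto F L 0≤L lipschitz =
    r x₀ , minimal
    where
    pulled : ∃[ x ] (∀ x′ → F (r x) ≤ F (r x′))
    pulled = attains (λ x → F (r x)) (L * K) (*-nonNeg 0≤L 0≤K) (λ x x′ → begin
      F (r x)                              ≤⟨ lipschitz (r x) (r x′) ⟩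
      F (r x′) + L * d′ (r x) (r x′)       ≤⟨ +-mono-≤ ≤-refl (*-monoˡ-≤ 0≤L (r-lipschitz x x′)) ⟩
      F (r x′) + L * (K * d x x′)          ≈⟨ +-congˡ (*-assoc L K (d x x′)) ⟨
      F (r x′) + L * K * d x x′            ∎)

    x₀ : X
    x₀ = proj₁ pulled

    minimal : ∀ y → F (r x₀) ≤ F y
    minimal y with r-onto y
    ... | x , rx~y = begin
      F (r x₀)                   ≤⟨ proj₂ pulled x ⟩
      F (r x)                    ≤⟨ lipschitz (r x) y ⟩
      F y + L * d′ (r x) y       ≤⟨ +-mono-≤ ≤-refl (*-monoˡ-≤ 0≤L rx~y) ⟩
      F y + L * 0#               ≈⟨ trans (+-congˡ (zeroʳ L)) (+-identityʳ (F y)) ⟩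
      F y                        ∎

module Simplex (ℝ : CompleteOrderedField) where
  open OrderedField ℝ
  open ≤-Reasoning

  dist₁ : ∀ {n} → Vector Carrier n → Vector Carrier n → Carrier
  dist₁ x y = ∥ (λ i → x i - y i) ∥₁

  dist₁-zero : ∀ {n} {x y : Vector Carrier n} → (∀ i → x i ≈ y i) → dist₁ x y ≈ 0#
  dist₁-zero {y = y} x≈y = sum-zero (λ i → x≈0⇒∣x∣≈0 (trans (+-congʳ (x≈y i)) (-‿inverseʳ (y i))))

  dist₁-nonNeg : ∀ {n} (x y : Vector Carrier n) → 0# ≤ dist₁ x y
  dist₁-nonNeg x y = sum-nonNeg (λ i → 0≤∣x∣ (x i - y i))

  vertex-nonNeg : ∀ {k} (i j : Fin k) → 0# ≤ vertex i j
  vertex-nonNeg i j with does (i Fin.≟ j)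
  ... | true  = 0≤1
  ... | false = ≤-refl

  sum-vertex : ∀ {k} (i : Fin k) → sum (vertex i) ≈ 1#
  sum-vertex {suc k} zero    = trans (+-congˡ (sum-zero {k} (λ _ → refl))) (+-identityʳ 1#)
  sum-vertex {suc k} (suc i) = trans (+-identityˡ _) (sum-vertex i)

  vertex∈Δ : ∀ {k} (i : Fin k) → Δ (vertex i)
  vertex∈Δ i = vertex-nonNeg i , sum-vertex i

  sum-*-vertex : ∀ {k} (p : Vector Carrier k) j → sum (λ i → p i * vertex i j) ≈ p j
  sum-*-vertex p zero    = trans (+-cong (*-identityʳ _) (sum-zero (λ i → zeroʳ (p (suc i)))))
    (+-identityʳ (p zero))
  sum-*-vertex p (suc j) = trans (+-cong (zeroʳ _) (sum-*-vertex (λ i → p (suc i)) j))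
    (+-identityˡ (p (suc j)))

  excess : Carrier → Carrier → Carrier
  excess s x = (s - x) ⊔ 0#

  excess-lipschitz : ∀ s t x y → ∣ excess s x - excess t y ∣ ≤ ∣ s - t ∣ + ∣ x - y ∣
  excess-lipschitz s t x y = ∣x-y∣≤z (le s t x y)
    (≤-respʳ-≈ (+-congˡ (+-cong (∣x-y∣≈∣y-x∣ t s) (∣x-y∣≈∣y-x∣ y x))) (le t s y x))
    where
    le : ∀ s t x y → excess s x ≤ excess t y + (∣ s - t ∣ + ∣ x - y ∣)
    le s t x y = ⊔-lub
      (begin
        s - x                                           ≤⟨ x≤y+z⇒x-y≤z s≤ ⟩
        (t - y) + (∣ s - t ∣ + ∣ x - y ∣)               ≤⟨ +-mono-≤ (x≤x⊔y (t - y) 0#) ≤-refl ⟩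
        excess t y + (∣ s - t ∣ + ∣ x - y ∣)            ∎)
      (+-nonNeg (x≤y⊔x (t - y) 0#) (+-nonNeg (0≤∣x∣ (s - t)) (0≤∣x∣ (x - y))))
      where
      s≤ : s ≤ x + ((t - y) + (∣ s - t ∣ + ∣ x - y ∣))
      s≤ = begin
        s                                               ≈⟨ solve 2 (λ s y → s := (s :+ y) :- y) refl s y ⟩
        (s + y) - y
          ≤⟨ +-mono-≤ (+-mono-≤ (x≤y+∣x-y∣ s t) (≤-respʳ-≈ (+-congˡ (∣x-y∣≈∣y-x∣ y x)) (x≤y+∣x-y∣ y x))) ≤-refl ⟩
        ((t + ∣ s - t ∣) + (x + ∣ x - y ∣)) - y
          ≈⟨ solve 5 (λ t x y a b → ((t :+ a) :+ (x :+ b)) :- y := x :+ ((t :- y) :+ (a :+ b))) refl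
               t x y ∣ s - t ∣ ∣ x - y ∣ ⟩
        x + ((t - y) + (∣ s - t ∣ + ∣ x - y ∣))         ∎

  -- Truncates the coordinates one after the other to what is left of the mass
  -- s, and puts the remaining mass into the last coordinate.
  fill : ∀ {n} → Carrier → Vector Carrier (suc n) → Vector Carrier (suc n)
  fill {zero}  s x = λ _ → s
  fill {suc n} s x = (s - excess s (head x)) ∷ fill (excess s (head x)) (tail x)

  fill-nonNeg : ∀ {n s} {x : Vector Carrier (suc n)} → 0# ≤ s → (∀ i → 0# ≤ x i) →
                ∀ i → 0# ≤ fill s x i
  fill-nonNeg {zero}          0≤s 0≤x i       = 0≤s
  fill-nonNeg {suc n} {s} {x} 0≤s 0≤x zero    = x≤y⇒0≤y-x (⊔-lub
    (x≤y+z⇒x-y≤z (≤-respʳ-≈ (+-comm s (x zero)) (x≤x+y (0≤x zero)))) 0≤s)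
  fill-nonNeg {suc n} {s} {x} 0≤s 0≤x (suc i) =
    fill-nonNeg (x≤y⊔x (s - x zero) 0#) (λ j → 0≤x (suc j)) i

  sum-fill : ∀ {n} s (x : Vector Carrier (suc n)) → sum (fill s x) ≈ s
  sum-fill {zero}  s x = +-identityʳ s
  sum-fill {suc n} s x = trans (+-congˡ (sum-fill (excess s (head x)) (tail x)))
    (solve 2 (λ s e → (s :- e) :+ e := s) refl s (excess s (head x)))

  fill-fixed : ∀ {n s} {x : Vector Carrier (suc n)} → (∀ i → 0# ≤ x i) → sum x ≈ s →
               ∀ i → fill s x i ≈ x i
  fill-fixed {zero}          0≤x ∑x≈s zero = trans (sym ∑x≈s) (+-identityʳ _)
  fill-fixed {suc n} {s} {x} 0≤x ∑x≈s      = fixed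
    where
    excess≈ : excess s (x zero) ≈ s - x zero
    excess≈ = x≥y⇒x⊔y≈x (x≤y⇒0≤y-x (≤-respʳ-≈ ∑x≈s (x≤sum 0≤x zero)))

    fixed : ∀ i → fill s x i ≈ x i
    fixed zero    = trans (+-congˡ (-‿cong excess≈))
      (solve 2 (λ s x → s :- (s :- x) := x) refl s (x zero))
    fixed (suc i) = fill-fixed (λ j → 0≤x (suc j)) (begin-equality
      sum (tail x)                       ≈⟨ solve 2 (λ a b → b := (a :+ b) :- a) refl (x zero) (sum (tail x)) ⟩
      (x zero + sum (tail x)) - x zero   ≈⟨ +-congʳ ∑x≈s ⟩
      s - x zero                         ≈⟨ excess≈ ⟨
      excess s (x zero)                  ∎) i

  fill-constant : ℕ → Carrier
  fill-constant zero    = 1#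
  fill-constant (suc n) = (1# + 1#) + fill-constant n

  fill-constant-nonNeg : ∀ n → 0# ≤ fill-constant n
  fill-constant-nonNeg zero    = 0≤1
  fill-constant-nonNeg (suc n) = +-nonNeg (+-nonNeg 0≤1 0≤1) (fill-constant-nonNeg n)

  fill-lipschitz : ∀ {n} s t (x y : Vector Carrier (suc n)) →
                   dist₁ (fill s x) (fill t y) ≤ fill-constant n * (∣ s - t ∣ + dist₁ x y)
  fill-lipschitz {zero} s t x y = ≤-respʳ-≈ (sym (*-identityˡ _))
    (+-mono-≤ ≤-refl (dist₁-nonNeg x y))
  fill-lipschitz {suc n} s t x y = begin
    ∣ (s - s′) - (t - t′) ∣ + dist₁ (fill s′ (tail x)) (fill t′ (tail y))
      ≤⟨ +-mono-≤ head-bound (≤-trans (fill-lipschitz s′ t′ (tail x) (tail y))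
           (*-monoˡ-≤ (fill-constant-nonNeg n) (+-mono-≤ (excess-lipschitz s t (head x) (head y)) ≤-refl))) ⟩
    (a + (a + b)) + K * ((a + b) + d)
      ≤⟨ 0≤d∧y≈x+d⇒x≤y (+-nonNeg (0≤∣x∣ _) (+-nonNeg 0≤d 0≤d))
           (solve 4 (λ a b d k → ((con 1ℤ :+ con 1ℤ) :+ k) :* (a :+ (b :+ d)) :=
               ((a :+ (a :+ b)) :+ k :* ((a :+ b) :+ d)) :+ (b :+ (d :+ d))) refl a b d K) ⟩
    ((1# + 1#) + K) * (a + (b + d))    ∎
    where
    s′ t′ a b d K : Carrier
    s′ = excess s (head x)
    t′ = excess t (head y)
    a = ∣ s - t ∣
    b = ∣ head x - head y ∣
    d = dist₁ (tail x) (tail y)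
    K = fill-constant n

    0≤d : 0# ≤ d
    0≤d = dist₁-nonNeg (tail x) (tail y)

    head-bound : ∣ (s - s′) - (t - t′) ∣ ≤ a + (a + b)
    head-bound = begin
      ∣ (s - s′) - (t - t′) ∣
        ≈⟨ ∣∣-cong (solve 4 (λ s s′ t t′ → (s :- s′) :- (t :- t′) := (s :- t) :+ (t′ :- s′)) refl s s′ t t′) ⟩
      ∣ (s - t) + (t′ - s′) ∣            ≤⟨ ∣x+y∣≤∣x∣+∣y∣ (s - t) (t′ - s′) ⟩
      a + ∣ t′ - s′ ∣                    ≈⟨ +-congˡ (∣x-y∣≈∣y-x∣ t′ s′) ⟩
      a + ∣ s′ - t′ ∣                    ≤⟨ +-mono-≤ ≤-refl (excess-lipschitz s t (head x) (head y)) ⟩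
      a + (a + b)                        ∎

module NormProperties (em : ExcludedMiddle 0ℓ) (ℝ : CompleteOrderedField) where
  open OrderedField ℝ
  open Simplex ℝ
  open ≤-Reasoning

  module _ {k} (N : Norm k) where
    open Norm N

    norm-zero : ∀ {x} → (∀ i → x i ≈ 0#) → ∥ x ∥ ≈ 0#
    norm-zero {x} x≈0 = begin-equality
      ∥ x ∥                   ≈⟨ cong (λ i → trans (x≈0 i) (sym (zeroˡ (x i)))) ⟩
      ∥ (λ i → 0# * x i) ∥    ≈⟨ homogeneous 0# x ⟩
      ∣ 0# ∣ * ∥ x ∥          ≈⟨ *-congʳ (x≈0⇒∣x∣≈0 refl) ⟩
      0# * ∥ x ∥              ≈⟨ zeroˡ ∥ x ∥ ⟩
      0#                      ∎

    norm-scale : ∀ {a} (x : Vector Carrier k) → 0# ≤ a → ∥ (λ i → a * x i) ∥ ≈ a * ∥ x ∥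
    norm-scale x 0≤a = trans (homogeneous _ x) (*-congʳ (0≤x⇒∣x∣≈x 0≤a))

    norm-neg : ∀ (x : Vector Carrier k) → ∥ (λ i → - x i) ∥ ≈ ∥ x ∥
    norm-neg x = begin-equality
      ∥ (λ i → - x i) ∥         ≈⟨ cong (λ i → solve 1 (λ x → :- x := (:- con 1ℤ) :* x) refl (x i)) ⟩
      ∥ (λ i → (- 1#) * x i) ∥  ≈⟨ homogeneous (- 1#) x ⟩
      ∣ - 1# ∣ * ∥ x ∥          ≈⟨ *-congʳ (trans (x≤0⇒∣x∣≈-x (0≤x⇒-x≤0 0≤1)) (-‿involutive 1#)) ⟩
      1# * ∥ x ∥                ≈⟨ *-identityˡ ∥ x ∥ ⟩
      ∥ x ∥                     ∎

    norm-swap : ∀ (x y : Vector Carrier k) → ∥ (λ i → x i - y i) ∥ ≈ ∥ (λ i → y i - x i) ∥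
    norm-swap x y = trans
      (cong (λ i → solve 2 (λ x y → x :- y := :- (y :- x)) refl (x i) (y i)))
      (norm-neg (λ i → y i - x i))

    norm-nonNeg : ∀ x → 0# ≤ ∥ x ∥
    norm-nonNeg x with total 0# ∥ x ∥
    ... | inj₁ 0≤∥x∥ = 0≤∥x∥
    ... | inj₂ ∥x∥≤0 = begin
      0#                              ≈⟨ norm-zero (λ i → -‿inverseʳ (x i)) ⟨
      ∥ (λ i → x i - x i) ∥           ≤⟨ triangle x (λ i → - x i) ⟩
      ∥ x ∥ + ∥ (λ i → - x i) ∥       ≈⟨ +-congˡ (norm-neg x) ⟩
      ∥ x ∥ + ∥ x ∥                   ≤⟨ +-mono-≤ ≤-refl ∥x∥≤0 ⟩
      ∥ x ∥ + 0#                      ≈⟨ +-identityʳ ∥ x ∥ ⟩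
      ∥ x ∥                           ∎

    norm-combination : ∀ {n} {a : Vector Carrier n} {c} (v : Fin n → Vector Carrier k) →
      (∀ l → 0# ≤ a l) → (∀ l → ∥ v l ∥ ≤ c) →
      ∥ (λ i → sum (λ l → a l * v l i)) ∥ ≤ sum a * c
    norm-combination {zero}  {a} {c} v 0≤a ∥v∥≤c =
      ≤-reflexive (trans (norm-zero (λ _ → refl)) (sym (zeroˡ c)))
    norm-combination {suc n} {a} {c} v 0≤a ∥v∥≤c = begin
      ∥ (λ i → a zero * v zero i + sum (λ l → a (suc l) * v (suc l) i)) ∥
        ≤⟨ triangle (λ i → a zero * v zero i) _ ⟩
      ∥ (λ i → a zero * v zero i) ∥ + ∥ (λ i → sum (λ l → a (suc l) * v (suc l) i)) ∥
        ≤⟨ +-mono-≤ (≤-respˡ-≈ (sym (norm-scale (v zero) (0≤a zero))) (*-monoˡ-≤ (0≤a zero) (∥v∥≤c zero)))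
             (norm-combination (λ l → v (suc l)) (λ l → 0≤a (suc l)) (λ l → ∥v∥≤c (suc l))) ⟩
      a zero * c + sum (λ l → a (suc l)) * c     ≈⟨ distribʳ c (a zero) _ ⟨
      sum a * c                                  ∎

    norm-centred-combination : ∀ {n} {a : Vector Carrier n} {c} (v : Fin n → Vector Carrier k) (w : Vector Carrier k) →
      (∀ l → 0# ≤ a l) → (∀ l → ∥ (λ i → v l i - w i) ∥ ≤ c) →
      ∥ (λ i → sum (λ l → a l * v l i) - sum a * w i) ∥ ≤ sum a * c
    norm-centred-combination {a = a} v w 0≤a ∥v-w∥≤c =
      ≤-respˡ-≈ (cong (λ i → eq a (λ l → v l i) (w i)))
        (norm-combination (λ l i → v l i - w i) 0≤a ∥v-w∥≤c)
      where
      eq : ∀ {n} (a f : Vector Carrier n) y →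
           sum (λ l → a l * (f l - y)) ≈ sum (λ l → a l * f l) - sum a * y
      eq {zero}  a f y = solve 1 (λ y → con 0ℤ := con 0ℤ :- con 0ℤ :* y) refl y
      eq {suc n} a f y = trans (+-congˡ (eq (tail a) (tail f) y))
        (solve 5 (λ a f y s t → a :* (f :- y) :+ (s :- t :* y) := (a :* f :+ s) :- (a :+ t) :* y) refl
          (a zero) (f zero) y (sum (λ l → a (suc l) * f (suc l))) (sum (tail a)))

    VertexDistances≤1 : Set
    VertexDistances≤1 = ∀ i j → ∥ (λ l → vertex i l - vertex j l) ∥ ≤ 1#

    -- With P the common mass, P (q − p) = ∑ⱼ qⱼ (P eⱼ − p) and
    -- p − P eⱼ = ∑ᵢ pᵢ (eᵢ − eⱼ).
    norm-difference≤mass : VertexDistances≤1 → ∀ {p q} → (∀ i → 0# ≤ p i) → (∀ i → 0# ≤ q i) →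
      sum p ≈ sum q → ∥ (λ i → p i - q i) ∥ ≤ sum p
    norm-difference≤mass diam {p} {q} 0≤p 0≤q ∑p≈∑q with em {P = sum p ≈ 0#}
    ... | yes ∑p≈0 = ≤-reflexive (trans (norm-zero (λ i → trans
            (+-cong (vanishes 0≤p ∑p≈0 i) (-‿cong (vanishes 0≤q (trans (sym ∑p≈∑q) ∑p≈0) i)))
            (-‿inverseʳ 0#)))
          (sym ∑p≈0))
      where
      vanishes : ∀ {n} {f : Vector Carrier n} → (∀ i → 0# ≤ f i) → sum f ≈ 0# → ∀ i → f i ≈ 0#
      vanishes 0≤f ∑f≈0 i = antisym (≤-respʳ-≈ ∑f≈0 (x≤sum 0≤f i)) (0≤f i)
    ... | no  ∑p≉0 = *-cancelˡ-≤ 0≤P ∑p≉0 (begin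
        P * ∥ (λ i → p i - q i) ∥                 ≈⟨ *-congˡ (norm-swap p q) ⟩
        P * ∥ (λ i → q i - p i) ∥                 ≈⟨ norm-scale (λ i → q i - p i) 0≤P ⟨
        ∥ (λ i → P * (q i - p i)) ∥               ≈⟨ cong expand ⟩
        ∥ (λ i → sum (λ j → q j * (P * vertex j i)) - sum q * p i) ∥
          ≤⟨ norm-centred-combination (λ j i → P * vertex j i) p 0≤q to-vertex ⟩
        sum q * P                                 ≈⟨ *-congʳ ∑p≈∑q ⟨
        P * P                                     ∎)
      where
      P : Carrier
      P = sum p

      0≤P : 0# ≤ P
      0≤P = sum-nonNeg 0≤p

      to-vertex : ∀ j → ∥ (λ i → P * vertex j i - p i) ∥ ≤ P
      to-vertex j = begin
        ∥ (λ i → P * vertex j i - p i) ∥          ≈⟨ norm-swap (λ i → P * vertex j i) p ⟩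
        ∥ (λ i → p i - P * vertex j i) ∥          ≈⟨ cong (λ i → +-congʳ (sum-*-vertex p i)) ⟨
        ∥ (λ i → sum (λ l → p l * vertex l i) - P * vertex j i) ∥
          ≤⟨ norm-centred-combination vertex (vertex j) 0≤p (λ l → diam l j) ⟩
        P * 1#                                    ≈⟨ *-identityʳ P ⟩
        P                                         ∎

      expand : ∀ i → P * (q i - p i) ≈ sum (λ j → q j * (P * vertex j i)) - sum q * p i
      expand i = begin-equality
        P * (q i - p i)                           ≈⟨ solve 3 (λ P q p → P :* (q :- p) := P :* q :- P :* p) refl P (q i) (p i) ⟩
        P * q i - P * p i                         ≈⟨ +-cong (*-congˡ (sym (sum-*-vertex q i))) (-‿cong (*-congʳ ∑p≈∑q)) ⟩
        P * sum (λ j → q j * vertex j i) - sum q * p i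
          ≈⟨ +-congʳ (*-distribˡ-sum P (λ j → q j * vertex j i)) ⟩
        sum (λ j → P * (q j * vertex j i)) - sum q * p i
          ≈⟨ +-congʳ (sum-cong-≋ (λ j → solve 3 (λ P q v → P :* (q :* v) := q :* (P :* v)) refl P (q j) (vertex j i))) ⟩
        sum (λ j → q j * (P * vertex j i)) - sum q * p i  ∎

    norm≤½ℓ₁ : VertexDistances≤1 → ∀ {x y} → Δ x → Δ y →
               ∥ (λ i → x i - y i) ∥ ≤ ½ * dist₁ x y
    norm≤½ℓ₁ diam {x} {y} (_ , ∑x≈1) (_ , ∑y≈1) = begin
      ∥ z ∥                        ≈⟨ cong (λ i → p-q≈z (z i)) ⟨
      ∥ (λ i → p i - q i) ∥        ≤⟨ norm-difference≤mass diam (λ i → x≤y⊔x (z i) 0#) (λ i → x≤y⊔x (- z i) 0#) ∑p≈∑q ⟩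
      sum p                        ≈⟨ solve 1 (λ s → s := con 1ℤ :* s) refl (sum p) ⟩
      1# * sum p                   ≈⟨ *-congʳ 2*½≈1 ⟨
      (1# + 1#) * ½ * sum p        ≈⟨ solve 2 (λ h s → (con 1ℤ :+ con 1ℤ) :* h :* s := h :* (s :+ s)) refl ½ (sum p) ⟩
      ½ * (sum p + sum p)          ≈⟨ *-congˡ (+-congˡ ∑p≈∑q) ⟩
      ½ * (sum p + sum q)          ≈⟨ *-congˡ (∑-distrib-+ p q) ⟨
      ½ * sum (λ i → p i + q i)    ≈⟨ *-congˡ (sum-cong-≋ (λ i → p+q≈∣z∣ (z i))) ⟩
      ½ * dist₁ x y                ∎
      where
      z p q : Vector Carrier k
      z i = x i - y i
      p i = z i ⊔ 0#
      q i = (- z i) ⊔ 0#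

      p-q≈z : ∀ z → (z ⊔ 0#) - ((- z) ⊔ 0#) ≈ z
      p-q≈z z = [ nonNeg , nonPos ]′ (total 0# z)
        where
        nonNeg : 0# ≤ z → (z ⊔ 0#) - ((- z) ⊔ 0#) ≈ z
        nonNeg 0≤z = trans (+-cong (x≥y⇒x⊔y≈x 0≤z) (-‿cong (x≤y⇒x⊔y≈y (0≤x⇒-x≤0 0≤z))))
          (solve 1 (λ z → z :- con 0ℤ := z) refl z)
        nonPos : z ≤ 0# → (z ⊔ 0#) - ((- z) ⊔ 0#) ≈ z
        nonPos z≤0 = trans (+-cong (x≤y⇒x⊔y≈y z≤0) (-‿cong (x≥y⇒x⊔y≈x (x≤0⇒0≤-x z≤0))))
          (solve 1 (λ z → con 0ℤ :- (:- z) := z) refl z)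

      p+q≈∣z∣ : ∀ z → (z ⊔ 0#) + ((- z) ⊔ 0#) ≈ ∣ z ∣
      p+q≈∣z∣ z = [ nonNeg , nonPos ]′ (total 0# z)
        where
        nonNeg : 0# ≤ z → (z ⊔ 0#) + ((- z) ⊔ 0#) ≈ ∣ z ∣
        nonNeg 0≤z = trans (+-cong (x≥y⇒x⊔y≈x 0≤z) (x≤y⇒x⊔y≈y (0≤x⇒-x≤0 0≤z)))
          (trans (+-identityʳ z) (sym (0≤x⇒∣x∣≈x 0≤z)))
        nonPos : z ≤ 0# → (z ⊔ 0#) + ((- z) ⊔ 0#) ≈ ∣ z ∣
        nonPos z≤0 = trans (+-cong (x≤y⇒x⊔y≈y z≤0) (x≥y⇒x⊔y≈x (x≤0⇒0≤-x z≤0)))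
          (trans (+-identityˡ (- z)) (sym (x≤0⇒∣x∣≈-x z≤0)))

      ∑p+1≈∑q+1 : sum p + 1# ≈ sum q + 1#
      ∑p+1≈∑q+1 = begin-equality
        sum p + 1#                     ≈⟨ +-congˡ ∑y≈1 ⟨
        sum p + sum y                  ≈⟨ ∑-distrib-+ p y ⟨
        sum (λ i → p i + y i)          ≈⟨ sum-cong-≋ (λ i → shift i) ⟩
        sum (λ i → q i + x i)          ≈⟨ ∑-distrib-+ q x ⟩
        sum q + sum x                  ≈⟨ +-congˡ ∑x≈1 ⟩
        sum q + 1#                     ∎
        where
        shift : ∀ i → p i + y i ≈ q i + x i
        shift i = begin-equality
          p i + y i                    ≈⟨ solve 3 (λ p q y → p :+ y := q :+ ((p :- q) :+ y)) refl (p i) (q i) (y i) ⟩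
          q i + ((p i - q i) + y i)    ≈⟨ +-congˡ (+-congʳ (p-q≈z (z i))) ⟩
          q i + ((x i - y i) + y i)    ≈⟨ +-congˡ (solve 2 (λ x y → (x :- y) :+ y := x) refl (x i) (y i)) ⟩
          q i + x i                    ∎

      ∑p≈∑q : sum p ≈ sum q
      ∑p≈∑q = begin-equality
        sum p                ≈⟨ solve 1 (λ s → s := (s :+ con 1ℤ) :- con 1ℤ) refl (sum p) ⟩
        (sum p + 1#) - 1#    ≈⟨ +-congʳ ∑p+1≈∑q+1 ⟩
        (sum q + 1#) - 1#    ≈⟨ solve 1 (λ s → s := (s :+ con 1ℤ) :- con 1ℤ) refl (sum q) ⟨
        sum q                ∎

module MultiwayCut (em : ExcludedMiddle 0ℓ) (ℝ : CompleteOrderedField) where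
  open OrderedField ℝ
  open Minimisation em ℝ
  open Simplex ℝ
  open NormProperties em ℝ
  open AddSupremum _≤_ using ([_]; _≤⊤⁺)
  open ≤-Reasoning

  supremum-exists : (P : Pred Carrier 0ℓ) → ∃ P → ∃[ s ] IsSupremum P s
  supremum-exists P inhabited with em {P = ∃[ b ] (∀ x → P x → x ≤ b)}
  ... | yes bounded with complete P inhabited bounded
  ...   | s , upper , least = [ s ] , (λ x Px → [ upper x Px ]) , least⁺
    where
    least⁺ : ∀ b → IsUpperBound P b → [ s ] ≤⁺ b
    least⁺ ⊤⁺    ub = [ s ] ≤⊤⁺
    least⁺ [ b ] ub = [ least b (λ x Px → AddSupremum.[≤]-injective _≤_ (ub x Px)) ]
  supremum-exists P inhabited | no unbounded = ⊤⁺ , (λ x Px → [ x ] ≤⊤⁺) , least⁺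
    where
    least⁺ : ∀ b → IsUpperBound P b → ⊤⁺ ≤⁺ b
    least⁺ ⊤⁺    ub = ⊤⁺ ≤⊤⁺
    least⁺ [ b ] ub = contradiction (b , λ x Px → AddSupremum.[≤]-injective _≤_ (ub x Px)) unbounded

  SimplexPoint : ℕ → Set
  SimplexPoint k = ∃[ x ] Δ {k} x

  simplex-attains : ∀ m → AttainsMinima (SimplexPoint (suc m)) (λ x y → dist₁ (proj₁ x) (proj₁ y))
  simplex-attains m = image-attains
    (vector-attains interval-attains (λ x → x≈0⇒∣x∣≈0 (-‿inverseʳ (proj₁ x))) (suc m))
    (λ x → fill 1# (λ i → proj₁ (x i)) ,
      fill-nonNeg 0≤1 (λ i → proj₁ (proj₂ (x i))) , sum-fill 1# (λ i → proj₁ (x i)))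
    (fill-constant m) (fill-constant-nonNeg m)
    (λ x y → ≤-respʳ-≈ (*-congˡ (trans (+-congʳ (x≈0⇒∣x∣≈0 (-‿inverseʳ 1#))) (+-identityˡ _)))
      (fill-lipschitz 1# 1# (λ i → proj₁ (x i)) (λ i → proj₁ (y i))))
    (λ { (y , 0≤y , ∑y≈1) →
      (λ i → y i , 0≤y i , ≤-respʳ-≈ ∑y≈1 (x≤sum 0≤y i)) ,
      ≤-reflexive (dist₁-zero (fill-fixed 0≤y ∑y≈1)) })

  module _ {k} (G : Instance k) where
    open Instance G
    open Embedding

    distᴱ : Embedding G → Embedding G → Carrier
    distᴱ E E′ = sum (λ u → dist₁ (φ E u) (φ E′ u))

    place : ∀ {u} → Dec (∃[ i ] terminal i ≡ u) → SimplexPoint k → SimplexPoint k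
    place (yes (i , _)) x = vertex i , vertex∈Δ i
    place (no _)        x = x

    terminal? : ∀ u → Dec (∃[ i ] terminal i ≡ u)
    terminal? u = Fin.any? (λ i → terminal i Fin.≟ u)

    place-terminal : ∀ i (d : Dec (∃[ j ] terminal j ≡ terminal i)) x l →
                     proj₁ (place d x) l ≈ vertex i l
    place-terminal i (yes (j , eq)) x l = reflexive (≡.cong (λ j → vertex j l) (terminal-inj eq))
    place-terminal i (no none)      x l = contradiction (i , ≡.refl) none

    embed : Vector (SimplexPoint k) #nodes → Embedding G
    embed x = record
      { φ          = λ u → proj₁ (place (terminal? u) (x u))
      ; φ∈Δ        = λ u → proj₂ (place (terminal? u) (x u))
      ; φ-terminal = λ i l → place-terminal i (terminal? (terminal i)) (x (terminal i)) l
      }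

    embedding-attains : AttainsMinima (SimplexPoint k) (λ x y → dist₁ (proj₁ x) (proj₁ y)) →
                        AttainsMinima (Embedding G) distᴱ
    embedding-attains attains = image-attains
      (vector-attains attains (λ x → dist₁-zero {x = proj₁ x} (λ _ → refl)) #nodes)
      embed 1# 0≤1
      (λ x y → ≤-respʳ-≈ (sym (*-identityˡ _)) (sum-mono-≤ (λ u → contracts (terminal? u) (x u) (y u))))
      (λ E → (λ u → φ E u , φ∈Δ E u) ,
        ≤-reflexive (sum-zero (λ u → dist₁-zero (recovers E (terminal? u)))))
      where
      contracts : ∀ {u} (d : Dec (∃[ i ] terminal i ≡ u)) x y →
                  dist₁ (proj₁ (place d x)) (proj₁ (place d y)) ≤ dist₁ (proj₁ x) (proj₁ y)
      contracts (yes (i , _)) x y = ≤-respˡ-≈ (sym (dist₁-zero {x = vertex i} (λ _ → refl)))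
        (dist₁-nonNeg (proj₁ x) (proj₁ y))
      contracts (no _)        x y = ≤-refl

      recovers : ∀ E {u} (d : Dec (∃[ i ] terminal i ≡ u)) l →
                 proj₁ (place d (φ E u , φ∈Δ E u)) l ≈ φ E u l
      recovers E (yes (i , ≡.refl)) l = sym (φ-terminal E i l)
      recovers E (no _)             l = refl

    vol-nonNeg : ∀ N (E : Embedding G) → 0# ≤ vol G N E
    vol-nonNeg N E = sum-nonNeg (λ e → *-nonNeg (cost-nonNeg e) (norm-nonNeg N _))

    cutCost-nonNeg : ∀ C → 0# ≤ cutCost G C
    cutCost-nonNeg C = sum-nonNeg term-nonNeg
      where
      term-nonNeg : ∀ e → 0# ≤ (if lookup C e then cost e else 0#)
      term-nonNeg e with lookup C e
      ... | true  = cost-nonNeg e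
      ... | false = ≤-refl

    vol≤vol-½ℓ₁ : ∀ N → VertexDistances≤1 N → (E : Embedding G) → vol G N E ≤ vol G (½ℓ₁ k) E
    vol≤vol-½ℓ₁ N diam E = sum-mono-≤ (λ e →
      *-monoˡ-≤ (cost-nonNeg e) (norm≤½ℓ₁ N diam (φ∈Δ E (src e)) (φ∈Δ E (tgt e))))

    vol-lipschitz : ∀ N → VertexDistances≤1 N → ∀ E E′ →
                    vol G N E ≤ vol G N E′ + sum cost * distᴱ E E′
    vol-lipschitz N diam E E′ = begin
      sum (λ e → cost e * ℓ E e)
        ≤⟨ sum-mono-≤ (λ e → *-monoˡ-≤ (cost-nonNeg e) (edge-bound e)) ⟩
      sum (λ e → cost e * (ℓ E′ e + D))
        ≈⟨ sum-cong-≋ (λ e → solve 3 (λ c l d → c :* (l :+ d) := c :* l :+ d :* c) refl (cost e) (ℓ E′ e) D) ⟩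
      sum (λ e → cost e * ℓ E′ e + D * cost e)
        ≈⟨ ∑-distrib-+ (λ e → cost e * ℓ E′ e) (λ e → D * cost e) ⟩
      vol G N E′ + sum (λ e → D * cost e)     ≈⟨ +-congˡ (*-distribˡ-sum D cost) ⟨
      vol G N E′ + D * sum cost               ≈⟨ +-congˡ (*-comm D (sum cost)) ⟩
      vol G N E′ + sum cost * D               ∎
      where
      open Norm N
      D : Carrier
      D = distᴱ E E′

      ℓ : Embedding G → Fin #edges → Carrier
      ℓ E e = ∥ (λ i → φ E (src e) i - φ E (tgt e) i) ∥

      displacement : ∀ u → ∥ (λ i → φ E u i - φ E′ u i) ∥ ≤ ½ * D
      displacement u = ≤-trans (norm≤½ℓ₁ N diam (φ∈Δ E u) (φ∈Δ E′ u))
        (*-monoˡ-≤ 0≤½ (x≤sum (λ u → dist₁-nonNeg (φ E u) (φ E′ u)) u))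

      edge-bound : ∀ e → ℓ E e ≤ ℓ E′ e + D
      edge-bound e = begin
        ℓ E e
          ≈⟨ cong (λ i → solve 4 (λ s t s′ t′ → s :- t := (s′ :- t′) :+ ((s :- s′) :+ (:- (t :- t′)))) refl
               (φ E (src e) i) (φ E (tgt e) i) (φ E′ (src e) i) (φ E′ (tgt e) i)) ⟩
        ∥ (λ i → edge′ i + (δs i + - δt i)) ∥           ≤⟨ triangle edge′ (λ i → δs i + - δt i) ⟩
        ℓ E′ e + ∥ (λ i → δs i + - δt i) ∥              ≤⟨ +-mono-≤ ≤-refl (triangle δs (λ i → - δt i)) ⟩
        ℓ E′ e + (∥ δs ∥ + ∥ (λ i → - δt i) ∥)          ≈⟨ +-congˡ (+-congˡ (norm-neg N δt)) ⟩
        ℓ E′ e + (∥ δs ∥ + ∥ δt ∥)                      ≤⟨ +-mono-≤ ≤-refl (+-mono-≤ (displacement (src e)) (displacement (tgt e))) ⟩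
        ℓ E′ e + (½ * D + ½ * D)
          ≈⟨ +-congˡ (solve 2 (λ h d → h :* d :+ h :* d := (con 1ℤ :+ con 1ℤ) :* h :* d) refl ½ D) ⟩
        ℓ E′ e + (1# + 1#) * ½ * D                      ≈⟨ +-congˡ (trans (*-congʳ 2*½≈1) (*-identityˡ D)) ⟩
        ℓ E′ e + D                                      ∎
        where
        edge′ δs δt : Vector Carrier k
        edge′ i = φ E′ (src e) i - φ E′ (tgt e) i
        δs i = φ E (src e) i - φ E′ (src e) i
        δt i = φ E (tgt e) i - φ E′ (tgt e) i

    vol-definite : ∀ N N′ (E : Embedding G) → vol G N E ≈ 0# → vol G N′ E ≈ 0#
    vol-definite N N′ E vol≈0 = sum-zero edge-zero
      where
      module N  = Norm N
      module N′ = Norm N′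

      edge : Fin #edges → Vector Carrier k
      edge e i = φ E (src e) i - φ E (tgt e) i

      term-zero : ∀ e → cost e * N.∥ edge e ∥ ≈ 0#
      term-zero e = antisym
        (≤-respʳ-≈ vol≈0 (x≤sum (λ e → *-nonNeg (cost-nonNeg e) (norm-nonNeg N (edge e))) e))
        (*-nonNeg (cost-nonNeg e) (norm-nonNeg N (edge e)))

      edge-zero : ∀ e → cost e * N′.∥ edge e ∥ ≈ 0#
      edge-zero e with em {P = cost e ≈ 0#}
      ... | yes cost≈0 = trans (*-congʳ cost≈0) (zeroˡ _)
      ... | no  cost≉0 = trans (*-congˡ (norm-zero N′ (N.definite ∥edge∥≈0))) (zeroʳ _)
        where
        ∥edge∥≈0 : N.∥ edge e ∥ ≈ 0#
        ∥edge∥≈0 = antisym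
          (*-cancelˡ-≤ (cost-nonNeg e) cost≉0 (≤-reflexive (trans (term-zero e) (sym (zeroʳ (cost e))))))
          (norm-nonNeg N (edge e))

  min-volume-exists : ∀ {m} (G : Instance (suc m)) N → VertexDistances≤1 N → ∃[ v ] IsMinVolume G N v
  min-volume-exists {m} G N diam = vol G N (proj₁ minimiser) , (proj₁ minimiser , refl) ,
    λ { x (E , x≈vol) → ≤-respʳ-≈ (sym x≈vol) (proj₂ minimiser E) }
    where
    minimiser : ∃[ E ] (∀ E′ → vol G N E ≤ vol G N E′)
    minimiser = embedding-attains G (simplex-attains m) (vol G N)
      (sum (Instance.cost G)) (sum-nonNeg (Instance.cost-nonNeg G)) (vol-lipschitz G N diam)

  ½ℓ₁-diameter : ∀ {k} → VertexDistances≤1 (½ℓ₁ k)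
  ½ℓ₁-diameter {k} i j = begin
    ½ * dist₁ (vertex i) (vertex j)               ≤⟨ *-monoˡ-≤ 0≤½ (sum-mono-≤ (λ l → ∣x-y∣≤x+y (vertex-nonNeg i l) (vertex-nonNeg j l))) ⟩
    ½ * sum (λ l → vertex i l + vertex j l)       ≈⟨ *-congˡ (∑-distrib-+ (vertex i) (vertex j)) ⟩
    ½ * (sum (vertex i) + sum (vertex j))         ≈⟨ *-congˡ (+-cong (sum-vertex i) (sum-vertex j)) ⟩
    ½ * (1# + 1#)                                 ≈⟨ trans (*-comm ½ (1# + 1#)) 2*½≈1 ⟩
    1#                                            ∎
    where
    ∣x-y∣≤x+y : ∀ {x y} → 0# ≤ x → 0# ≤ y → ∣ x - y ∣ ≤ x + y
    ∣x-y∣≤x+y {x} {y} 0≤x 0≤y = ∣x-y∣≤z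
      (0≤d∧y≈x+d⇒x≤y (+-nonNeg 0≤y 0≤y) (solve 2 (λ x y → y :+ (x :+ y) := x :+ (y :+ y)) refl x y))
      (0≤d∧y≈x+d⇒x≤y (+-nonNeg 0≤x 0≤x) (solve 2 (λ x y → x :+ (x :+ y) := y :+ (x :+ x)) refl x y))

  module _ {m} (G : Instance (suc m)) {C : Subset (Instance.#edges G)} (cut : IsCut G C) where
    open Instance G

    private
      Reached : Fin #nodes → Set
      Reached u = ∃[ i ] ConnectedOutside G C (terminal i) u

      label : ∀ {u} → Dec (Reached u) → Fin (suc m)
      label (yes (i , _)) = i
      label (no _)        = zero

      label-connected : ∀ {u v} (du : Dec (Reached u)) (dv : Dec (Reached v)) →
                        ConnectedOutside G C u v → label du ≡ label dv
      label-connected (yes (i , i~u)) (yes (j , j~v)) u~v with i Fin.≟ j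
      ... | yes i≡j = i≡j
      ... | no  i≢j = contradiction (i~u ◅◅ u~v ◅◅ EqClosure.symmetric _ j~v) (cut i j i≢j)
      label-connected (yes (i , i~u)) (no  none)      u~v = contradiction (i , i~u ◅◅ u~v) none
      label-connected (no  none)      (yes (j , j~v)) u~v =
        contradiction (j , j~v ◅◅ EqClosure.symmetric _ u~v) none
      label-connected (no  _)         (no  _)         u~v = ≡.refl

      label-terminal : ∀ i (d : Dec (Reached (terminal i))) → label d ≡ i
      label-terminal i d = label-connected d (yes (i , ε)) ε

    cut-embedding : Embedding G
    cut-embedding = record
      { φ          = λ u → vertex (label {u} em)
      ; φ∈Δ        = λ u → vertex∈Δ (label {u} em)
      ; φ-terminal = λ i l → reflexive (≡.cong (λ j → vertex j l) (label-terminal i em))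
      }

    cut-embedding-vol : ∀ N → VertexDistances≤1 N → vol G N cut-embedding ≤ cutCost G C
    cut-embedding-vol N diam = sum-mono-≤ edge-bound
      where
      open Norm N
      edge-bound : ∀ e → cost e * ∥ (λ i → vertex (label {src e} em) i - vertex (label {tgt e} em) i) ∥
                         ≤ (if lookup C e then cost e else 0#)
      edge-bound e with lookup C e in eq
      ... | true  = ≤-respʳ-≈ (*-identityʳ (cost e)) (*-monoˡ-≤ (cost-nonNeg e) (diam (label {src e} em) (label {tgt e} em)))
      ... | false = ≤-reflexive (trans
        (*-congˡ (norm-zero N (λ i → trans (+-congʳ (reflexive (≡.cong (λ j → vertex j i) same))) (-‿inverseʳ _))))
        (zeroʳ (cost e)))
        where
        e∉C : e ∉ C
        e∉C e∈C with ≡.trans (≡.sym eq) ([]=⇒lookup e∈C)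
        ... | ()

        same : label {src e} em ≡ label {tgt e} em
        same = label-connected em em (fwd (e , e∉C , ≡.refl , ≡.refl) ◅ ε)

  vertex-distances≤1⇒relaxation : ∀ {m} (N : Norm (suc m)) → VertexDistances≤1 N → IsRelaxation N
  vertex-distances≤1⇒relaxation N diam G v c (_ , minimal) ((C , cut , c≈cutCost) , _) = begin
    v                                  ≤⟨ minimal _ (cut-embedding G cut , refl) ⟩
    vol G N (cut-embedding G cut)      ≤⟨ cut-embedding-vol G cut N diam ⟩
    cutCost G C                        ≈⟨ c≈cutCost ⟨
    c                                  ∎

  edgeGraph : ∀ {k} {i j : Fin k} → i Fin.< j → Instance k
  edgeGraph {k} {i} {j} i<j = record
    { #nodes       = k
    ; #edges       = 1
    ; src          = λ _ → i
    ; tgt          = λ _ → j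
    ; src<tgt      = λ _ → i<j
    ; distinct     = λ { {zero} {zero} _ _ → ≡.refl }
    ; cost         = λ _ → 1#
    ; cost-nonNeg  = λ _ → 0≤1
    ; terminal     = id
    ; terminal-inj = id
    }

  module _ {k} {i j : Fin k} (i<j : i Fin.< j) where

    private
      G : Instance k
      G = edgeGraph i<j

    edgeGraph-minCut : IsMinCutCost G 1#
    edgeGraph-minCut = (⊤ , cut , sym (+-identityʳ 1#)) , minimal
      where
      cut : IsCut G ⊤
      cut a b a≢b ε = a≢b ≡.refl
      cut a b a≢b (fwd (zero , e∉⊤ , _) ◅ _) = e∉⊤ here
      cut a b a≢b (bwd (zero , e∉⊤ , _) ◅ _) = e∉⊤ here

      minimal : ∀ x → ∃[ C ] (IsCut G C × x ≈ cutCost G C) → 1# ≤ x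
      minimal x (C , isCut , x≈) with lookup C zero in eq
      ... | true  = ≤-reflexive (sym (trans x≈ (+-identityʳ 1#)))
      ... | false = contradiction
        (fwd (zero , zero∉C , ≡.refl , ≡.refl) ◅ ε) (isCut i j (λ { ≡.refl → Fin.<-irrefl ≡.refl i<j }))
        where
        zero∉C : zero ∉ C
        zero∉C zero∈C with ≡.trans (≡.sym eq) ([]=⇒lookup zero∈C)
        ... | ()

    module _ (N : Norm k) where
      open Norm N

      edgeGraph-vol : ∀ E → vol G N E ≈ ∥ (λ l → vertex i l - vertex j l) ∥
      edgeGraph-vol E = trans (+-identityʳ _) (trans (*-identityˡ _)
        (cong (λ l → +-cong (φ-terminal i l) (-‿cong (φ-terminal j l)))))
        where open Embedding E

      edgeGraph-minVolume : IsMinVolume G N ∥ (λ l → vertex i l - vertex j l) ∥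
      edgeGraph-minVolume = (E , sym (edgeGraph-vol E)) ,
        λ { x (E′ , x≈vol) → ≤-reflexive (sym (trans x≈vol (edgeGraph-vol E′))) }
        where
        E : Embedding G
        E = record { φ = vertex ; φ∈Δ = vertex∈Δ ; φ-terminal = λ _ _ → refl }

      edgeGraph-ratio : ∃[ r ] IsRatio N r
      edgeGraph-ratio = proj₁ inv , G , v , 1# , edgeGraph-minVolume , edgeGraph-minCut ,
        (norm-nonNeg N _ , λ 0≈v → v≉0 (sym 0≈v)) , trans (*-comm _ v) (proj₂ inv)
        where
        v : Carrier
        v = ∥ (λ l → vertex i l - vertex j l) ∥

        v≉0 : ¬ v ≈ 0#
        v≉0 v≈0 = separated i≢j (definite v≈0 i)
          where
          i≢j : ¬ j ≡ i
          i≢j ≡.refl = Fin.<-irrefl ≡.refl i<j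

          separated : ¬ j ≡ i → ¬ vertex i i - vertex j i ≈ 0#
          separated j≢i with i Fin.≟ i | j Fin.≟ i
          ... | no i≢i | _       = contradiction ≡.refl i≢i
          ... | yes _  | yes j≡i = contradiction j≡i j≢i
          ... | yes _  | no _    = λ 1-0≈0 →
            0≉1 (sym (trans (solve 0 (con 1ℤ := con 1ℤ :- con 0ℤ) refl) 1-0≈0))

        inv = inverse v v≉0

  relaxation⇒vertex-distances≤1 : ∀ {k} (N : Norm k) → IsRelaxation N → VertexDistances≤1 N
  relaxation⇒vertex-distances≤1 N relaxation i j with Fin.<-cmp i j
  ... | tri< i<j _ _     = relaxation (edgeGraph i<j) _ 1# (edgeGraph-minVolume i<j N) (edgeGraph-minCut i<j)
  ... | tri≈ _ ≡.refl _  = ≤-respˡ-≈ (sym (norm-zero N (λ l → -‿inverseʳ (vertex i l)))) 0≤1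
  ... | tri> _ _ j<i     = ≤-respˡ-≈ (norm-swap N (vertex j) (vertex i))
    (relaxation (edgeGraph j<i) _ 1# (edgeGraph-minVolume j<i N) (edgeGraph-minCut j<i))

  ratio-dominated : ∀ {m} (N : Norm (suc m)) → VertexDistances≤1 N → ∀ {r} → IsRatio (½ℓ₁ (suc m)) r →
                    ∃[ r′ ] (IsRatio N r′ × r ≤ r′)
  ratio-dominated {m} N diam {r}
    (G , v , c , ((E , v≈vol) , v-minimal) , minCut@((C , _ , c≈cutCost) , _) , (0≤v , 0≉v) , rv≈c) =
    r′ , (G , v′ , c , proj₂ minVolume , minCut , (0≤v′ , λ 0≈v′ → v′≉0 (sym 0≈v′)) , r′v′≈c) , r≤r′
    where
    minVolume : ∃[ v ] IsMinVolume G N v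
    minVolume = min-volume-exists G N diam

    v′ : Carrier
    v′ = proj₁ minVolume

    E′ : Embedding G
    E′ = proj₁ (proj₁ (proj₂ minVolume))

    v′≈vol : v′ ≈ vol G N E′
    v′≈vol = proj₂ (proj₁ (proj₂ minVolume))

    0≤v′ : 0# ≤ v′
    0≤v′ = ≤-respʳ-≈ (sym v′≈vol) (vol-nonNeg G N E′)

    v′≤v : v′ ≤ v
    v′≤v = begin
      v′                          ≤⟨ proj₂ (proj₂ minVolume) _ (E , refl) ⟩
      vol G N E                   ≤⟨ vol≤vol-½ℓ₁ G N diam E ⟩
      vol G (½ℓ₁ (suc m)) E       ≈⟨ v≈vol ⟨
      v                           ∎

    v′≉0 : ¬ v′ ≈ 0#
    v′≉0 v′≈0 = 0≉v (antisym 0≤v (v-minimal 0#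
      (E′ , sym (vol-definite G N (½ℓ₁ (suc m)) E′ (trans (sym v′≈vol) v′≈0)))))

    inv = inverse-nonNeg 0≤v′ v′≉0

    r′ : Carrier
    r′ = c * proj₁ inv

    0≤r′ : 0# ≤ r′
    0≤r′ = *-nonNeg (≤-respʳ-≈ (sym c≈cutCost) (cutCost-nonNeg G C)) (proj₂ (proj₂ inv))

    r′v′≈c : r′ * v′ ≈ c
    r′v′≈c = begin-equality
      c * proj₁ inv * v′          ≈⟨ solve 3 (λ c b v → c :* b :* v := c :* (v :* b)) refl c (proj₁ inv) v′ ⟩
      c * (v′ * proj₁ inv)        ≈⟨ *-congˡ (proj₁ (proj₂ inv)) ⟩
      c * 1#                      ≈⟨ *-identityʳ c ⟩
      c                           ∎

    r≤r′ : r ≤ r′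
    r≤r′ = *-cancelˡ-≤ 0≤v (λ v≈0 → 0≉v (sym v≈0)) (begin
      v * r                       ≈⟨ trans (*-comm v r) rv≈c ⟩
      c                           ≈⟨ r′v′≈c ⟨
      r′ * v′                     ≤⟨ *-monoˡ-≤ 0≤r′ v′≤v ⟩
      r′ * v                      ≈⟨ *-comm r′ v ⟩
      v * r′                      ∎)

  gap-exists : ∀ {m} (N : Norm (suc (suc m))) → ∃[ g ] IsIntegralityGap N g
  gap-exists N = supremum-exists (IsRatio N) (edgeGraph-ratio {i = zero} {j = suc zero} (s≤s z≤n) N)

  ½ℓ₁-gap-least : ∀ {m} (N : Norm (suc (suc m))) → IsRelaxation N →
    ∃[ g ] ∃[ g′ ] (IsIntegralityGap (½ℓ₁ (suc (suc m))) g × IsIntegralityGap N g′ × g ≤⁺ g′)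
  ½ℓ₁-gap-least {m} N relaxation = g , g′ , proj₂ (gap-exists (½ℓ₁ _)) , proj₂ (gap-exists N) ,
    proj₂ (proj₂ (gap-exists (½ℓ₁ _))) g′ bound
    where
    g g′ : Carrier ⁺
    g  = proj₁ (gap-exists (½ℓ₁ (suc (suc m))))
    g′ = proj₁ (gap-exists N)

    bound : IsUpperBound (IsRatio (½ℓ₁ _)) g′
    bound r r-ratio = AddSupremum.≤⁺-trans _≤_ ≤-trans [ proj₂ (proj₂ dominating) ]
      (proj₁ (proj₂ (gap-exists N)) (proj₁ dominating) (proj₁ (proj₂ dominating)))
      where
      dominating : ∃[ r′ ] (IsRatio N r′ × r ≤ r′)
      dominating = ratio-dominated N (relaxation⇒vertex-distances≤1 N relaxation) r-ratio

lemma2p6 : ExcludedMiddle 0ℓ →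
    (ℝ : CompleteOrderedField) → let open RealNumbers ℝ in
    (k : ℕ) → 3 ≤ᴺ k →
    IsRelaxation (½ℓ₁ k) ×
    ((N : Norm k) → IsRelaxation N →
    ∃[ g ] ∃[ g′ ] (IsIntegralityGap (½ℓ₁ k) g × IsIntegralityGap N g′ × g ≤⁺ g′))
lemma2p6 em ℝ (suc zero)      (s≤s ())
lemma2p6 em ℝ k@(suc (suc _)) _ =
  vertex-distances≤1⇒relaxation (½ℓ₁ k) ½ℓ₁-diameter , ½ℓ₁-gap-least
  where
  open RealNumbers ℝ
  open MultiwayCut em ℝ
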